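{- Let $\tilde c_g$ be the number of numerical semigroups of genus $g$ whose Frobenius number equals $3m-1$ where $m$ is the multiplicity (equivalently, the number of NSG-compositions $x_1+\cdots+x_{m-1}$ of genus $g$ with maximum $3$ and $x_{m-1}=3$). Then $\limsup_{g\to\infty}\tilde c_g^{1/g}<\omega=\frac{1+\sqrt5}2$; i.e. $\tilde C(q)=\sum_{g\ge3}\tilde c_gq^g$ converges on an open disc of radius strictly larger than $\omega^{ -1}$.
   Context: A numerical semigroup is a submonoid $S\subseteq(\mathbb N,+)$ with finite complement; genus $\#(\mathbb N\setminus S)$, multiplicity $m=\min(S\setminus\{0\})$, Frobenius number $\max(\mathbb N\setminus S)$. An NSG-composition is a composition $x_1+\cdots+x_{m-1}$ of positive integers satisfying $x_{s+t}\le x_s+x_t$ and $x_{m-s-t}\le x_{m-s}+x_{m-t}+1$ for all $s,t\ge1$, $s+t<m$; its genus is $\sum x_j$. -}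

module Defs where

open import Level using (0ℓ; _⊔_) renaming (suc to lsuc)
open import Data.Nat.Base as ℕ using (ℕ; zero; suc)
import Data.Integer.Base as ℤ
open import Data.Rational.Base as ℚ using (ℚ; 0ℚ; 1ℚ)
import Data.Rational.Properties as ℚ
open import Data.Rational.Solver using (module +-*-Solver)
open import Algebra.Definitions.RawSemiring ℚ.+-*-rawSemiring using (_^_)
open import Data.Empty using (⊥; ⊥-elim)
open import Data.Fin.Base using (Fin)
open import Data.List.Base using (List; []; _∷_; length; foldr)
open import Data.Nat.ListAction using (sum)
open import Data.List.Membership.Propositional using () renaming (_∈_ to _∈ˡ_)
open import Data.List.Relation.Unary.All using (All)
open import Data.List.Relation.Unary.Unique.Propositional using (Unique)
open import Data.Product.Base using (Σ-syntax; ∃; ∃-syntax; _×_; _,_; proj₁; proj₂)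
open import Data.Sum.Base using (_⊎_; inj₁; inj₂)
open import Function.Base using (_∘_)
open import Function.Bundles using (Inverse; _⇔_)
open import Relation.Binary.Bundles using (Setoid)
open import Relation.Binary.Definitions using (tri<; tri≈; tri>)
import Relation.Binary.Construct.On as On
open import Relation.Binary.PropositionalEquality
  using (_≡_; _≢_; refl; sym; trans; cong; subst; subst₂; setoid)
open import Relation.Nullary using (yes; no)
open import Relation.Unary using (Pred; Decidable; _∈_; _∉_)
import Relation.Unary.Relation.Binary.Equality as Pred

HasCardinality : ∀ {c ℓ} → Setoid c ℓ → ℕ → Set (c ⊔ ℓ)
HasCardinality S n = Inverse (setoid (Fin n)) S

-- Membership is required to be decidable and the finite complement is
-- listed without repetition; neither restricts the sets involved
-- classically.
record NumericalSemigroup : Set₁ where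
  field
    Carrier  : Pred ℕ 0ℓ
    carrier? : Decidable Carrier
    0∈       : 0 ∈ Carrier
    +-closed : ∀ {a b} → a ∈ Carrier → b ∈ Carrier → a ℕ.+ b ∈ Carrier
    gaps     : List ℕ
    gaps-unique : Unique gaps
    gaps-spec   : ∀ n → n ∈ˡ gaps ⇔ n ∉ Carrier

open NumericalSemigroup public using (Carrier; gaps)

genus : NumericalSemigroup → ℕ
genus S = length (gaps S)

IsMultiplicity : NumericalSemigroup → ℕ → Set
IsMultiplicity S m =
  m ∈ Carrier S × m ≢ 0 × (∀ n → n ∈ Carrier S → n ≢ 0 → m ℕ.≤ n)

IsFrobenius : NumericalSemigroup → ℕ → Set
IsFrobenius S f = f ∉ Carrier S × (∀ n → n ∉ Carrier S → n ℕ.≤ f)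

Frobenius≡3m-1 : NumericalSemigroup → Set
Frobenius≡3m-1 S = ∃[ m ] IsMultiplicity S m × IsFrobenius S (3 ℕ.* m ℕ.∸ 1)

-- Two semigroups are identified when they have the same elements.
Semigroups3m-1 : ℕ → Setoid (lsuc 0ℓ) 0ℓ
Semigroups3m-1 g = On.setoid
  {B = Σ[ S ∈ NumericalSemigroup ] (genus S ≡ g × Frobenius≡3m-1 S)}
  (Pred.≐-setoid ℕ 0ℓ)
  (Carrier ∘ proj₁)

-- part xs j is the j-th part, counted from 1; outside
-- 1 ≤ j ≤ length xs the value 0 is a dummy that no condition below relies on.
part : List ℕ → ℕ → ℕ
part []       _             = 0
part (x ∷ xs) zero          = 0
part (x ∷ xs) (suc zero)    = x
part (x ∷ xs) (suc (suc j)) = part xs (suc j)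

record NSGComposition : Set where
  field
    parts : List ℕ

  m : ℕ
  m = suc (length parts)

  x : ℕ → ℕ
  x = part parts

  field
    positive : All (1 ℕ.≤_) parts
    kunz₁ : ∀ s t → 1 ℕ.≤ s → 1 ℕ.≤ t → s ℕ.+ t ℕ.< m →
            x (s ℕ.+ t) ℕ.≤ x s ℕ.+ x t
    kunz₂ : ∀ s t → 1 ℕ.≤ s → 1 ℕ.≤ t → s ℕ.+ t ℕ.< m →
            x (m ℕ.∸ s ℕ.∸ t) ℕ.≤ x (m ℕ.∸ s) ℕ.+ x (m ℕ.∸ t) ℕ.+ 1

  compositionGenus : ℕ
  compositionGenus = sum parts

  maximum : ℕ
  maximum = foldr ℕ._⊔_ 0 parts

open NSGComposition public using (parts; compositionGenus; maximum)

Compositions3 : ℕ → Setoid 0ℓ 0ℓ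
Compositions3 g = On.setoid
  {B = Σ[ C ∈ NSGComposition ]
         (compositionGenus C ≡ g × maximum C ≡ 3 ×
          NSGComposition.x C (NSGComposition.m C ℕ.∸ 1) ≡ 3)}
  (setoid (List ℕ))
  (parts ∘ proj₁)

-- Two-sided located Dedekind cuts: L q means q < x, and U q means x < q.
record ℝ : Set₁ where
  field
    L U : ℚ → Set
    L-inhabited : ∃ L
    U-inhabited : ∃ U
    L-lower   : ∀ {q r} → q ℚ.< r → L r → L q
    U-upper   : ∀ {q r} → q ℚ.< r → U q → U r
    L-rounded : ∀ {q} → L q → ∃[ r ] q ℚ.< r × L r
    U-rounded : ∀ {q} → U q → ∃[ r ] r ℚ.< q × U r
    disjoint  : ∀ {q} → L q → U q → ⊥
    located   : ∀ {q r} → q ℚ.< r → L q ⊎ U r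

open ℝ public using (L; U)

infix 4 _<ℝ_
_<ℝ_ : ℝ → ℝ → Set
x <ℝ y = ∃[ q ] U x q × L y q

fromℚ : ℚ → ℝ
fromℚ p = record
  { L = λ q → q ℚ.< p
  ; U = λ q → p ℚ.< q
  ; L-inhabited = p ℚ.- 1ℚ ,
      subst (p ℚ.- 1ℚ ℚ.<_) (ℚ.+-identityʳ p)
        (ℚ.+-monoʳ-< p {ℚ.- 1ℚ} {0ℚ} (ℚ.negative⁻¹ (ℚ.- 1ℚ)))
  ; U-inhabited = p ℚ.+ 1ℚ ,
      subst (ℚ._< p ℚ.+ 1ℚ) (ℚ.+-identityʳ p)
        (ℚ.+-monoʳ-< p {0ℚ} {1ℚ} (ℚ.positive⁻¹ 1ℚ))
  ; L-lower   = ℚ.<-trans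
  ; U-upper   = λ q<r p<q → ℚ.<-trans p<q q<r
  ; L-rounded = λ q<p → let r , q<r , r<p = ℚ.<-dense q<p in r , q<r , r<p
  ; U-rounded = λ p<q → let r , p<r , r<q = ℚ.<-dense p<q in r , r<q , p<r
  ; disjoint  = λ q<p p<q → ℚ.<-asym q<p p<q
  ; located   = λ {q} {r} q<r → loc q<r
  }
  where
  loc : ∀ {q r} → q ℚ.< r → q ℚ.< p ⊎ p ℚ.< r
  loc {q} {r} q<r with q ℚ.<? p
  ... | yes q<p = inj₁ q<p
  ... | no  q≮p = inj₂ (ℚ.≤-<-trans (ℚ.≮⇒≥ q≮p) q<r)

infixl 6 _+ℝ_
_+ℝ_ : ℚ → ℝ → ℝ
p +ℝ x = record
  { L = λ q → L x (q ℚ.- p)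
  ; U = λ q → U x (q ℚ.- p)
  ; L-inhabited = let q , Lq = X.L-inhabited in q ℚ.+ p , subst (L x) (back q) Lq
  ; U-inhabited = let q , Uq = X.U-inhabited in q ℚ.+ p , subst (U x) (back q) Uq
  ; L-lower   = λ q<r → X.L-lower (ℚ.+-monoˡ-< (ℚ.- p) q<r)
  ; U-upper   = λ q<r → X.U-upper (ℚ.+-monoˡ-< (ℚ.- p) q<r)
  ; L-rounded = λ {q} Lq → let r , q<r , Lr = X.L-rounded Lq in
      r ℚ.+ p , subst (ℚ._< r ℚ.+ p) (forth q) (ℚ.+-monoˡ-< p q<r) , subst (L x) (back r) Lr
  ; U-rounded = λ {q} Uq → let r , r<q , Ur = X.U-rounded Uq in
      r ℚ.+ p , subst (r ℚ.+ p ℚ.<_) (forth q) (ℚ.+-monoˡ-< p r<q) , subst (U x) (back r) Ur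
  ; disjoint  = X.disjoint
  ; located   = λ q<r → X.located (ℚ.+-monoˡ-< (ℚ.- p) q<r)
  }
  where
  module X = ℝ x
  open +-*-Solver
  back : ∀ q → q ≡ q ℚ.+ p ℚ.- p
  back q = solve 2 (λ q p → q := q :+ p :- p) refl q p
  forth : ∀ q → q ℚ.- p ℚ.+ p ≡ q
  forth q = solve 2 (λ q p → q :- p :+ p := q) refl q p

halfℝ : ℝ → ℝ
halfℝ x = record
  { L = λ q → L x (q ℚ.+ q)
  ; U = λ q → U x (q ℚ.+ q)
  ; L-inhabited = let q , Lq = X.L-inhabited in ℚ.½ ℚ.* q , subst (L x) (back q) Lq
  ; U-inhabited = let q , Uq = X.U-inhabited in ℚ.½ ℚ.* q , subst (U x) (back q) Uq
  ; L-lower   = λ q<r → X.L-lower (ℚ.+-mono-< q<r q<r)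
  ; U-upper   = λ q<r → X.U-upper (ℚ.+-mono-< q<r q<r)
  ; L-rounded = λ {q} Lq → let r , q<r , Lr = X.L-rounded Lq in
      ℚ.½ ℚ.* r ,
      subst (ℚ._< ℚ.½ ℚ.* r) (forth q) (ℚ.*-monoʳ-<-pos ℚ.½ q<r) , subst (L x) (back r) Lr
  ; U-rounded = λ {q} Uq → let r , r<q , Ur = X.U-rounded Uq in
      ℚ.½ ℚ.* r ,
      subst (ℚ.½ ℚ.* r ℚ.<_) (forth q) (ℚ.*-monoʳ-<-pos ℚ.½ r<q) , subst (U x) (back r) Ur
  ; disjoint  = X.disjoint
  ; located   = λ q<r → X.located (ℚ.+-mono-< q<r q<r)
  }
  where
  module X = ℝ x
  open +-*-Solver
  back : ∀ q → q ≡ ℚ.½ ℚ.* q ℚ.+ ℚ.½ ℚ.* q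
  back q = solve 1 (λ q → q := con ℚ.½ :* q :+ con ℚ.½ :* q) refl q
  forth : ∀ q → ℚ.½ ℚ.* (q ℚ.+ q) ≡ q
  forth q = solve 1 (λ q → con ℚ.½ :* (q :+ q) := q) refl q

-- The inverse of x > 0: q < 1/x iff q r < 1 for some r > x, and
-- 1/x < q iff 1 < q r for some 0 < r < x.
recip : (x : ℝ) → L x 0ℚ → ℝ
recip x 0<x = record
  { L = L′
  ; U = U′
  ; L-inhabited = let u , Uu = X.U-inhabited in
      0ℚ , u , Uu , subst (ℚ._< 1ℚ) (sym (ℚ.*-zeroˡ u)) (ℚ.positive⁻¹ 1ℚ)
  ; U-inhabited = U-inh
  ; L-lower   = λ { q<r (s , Us , rs<1) →
      s , Us , ℚ.<-trans (ℚ.*-monoˡ-<-pos s {{ℚ.positive (U⇒pos Us)}} q<r) rs<1 }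
  ; U-upper   = λ { q<r (s , Ls , 0<s , 1<qs) →
      s , Ls , 0<s , ℚ.<-trans 1<qs (ℚ.*-monoˡ-<-pos s {{ℚ.positive 0<s}} q<r) }
  ; L-rounded = L-rnd
  ; U-rounded = U-rnd
  ; disjoint  = λ {q} → disj {q}
  ; located   = loc
  }
  where
  module X = ℝ x

  L′ U′ : ℚ → Set
  L′ q = ∃[ r ] U x r × q ℚ.* r ℚ.< 1ℚ
  U′ q = ∃[ r ] L x r × 0ℚ ℚ.< r × 1ℚ ℚ.< q ℚ.* r

  L<U : ∀ {q r} → L x q → U x r → q ℚ.< r
  L<U {q} {r} Lq Ur with ℚ.<-cmp q r
  ... | tri< q<r _ _  = q<r
  ... | tri≈ _ refl _ = ⊥-elim (X.disjoint Lq Ur)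
  ... | tri> _ _ r<q  = ⊥-elim (X.disjoint (X.L-lower r<q Lq) Ur)

  U⇒pos : ∀ {r} → U x r → 0ℚ ℚ.< r
  U⇒pos = L<U 0<x

  divide : ∀ p s → 0ℚ ℚ.< s → ∃[ r ] r ℚ.* s ≡ p
  divide p s 0<s = p ℚ.* inv , trans (ℚ.*-assoc p inv s)
      (trans (cong (p ℚ.*_) (ℚ.*-inverseˡ s {{nz}})) (ℚ.*-identityʳ p))
    where
    nz  = ℚ.pos⇒nonZero s {{ℚ.positive 0<s}}
    inv = ℚ.1/_ s {{nz}}

  cancel-< : ∀ {p q s} → 0ℚ ℚ.< s → p ℚ.* s ℚ.< q ℚ.* s → p ℚ.< q
  cancel-< {s = s} 0<s = ℚ.*-cancelʳ-<-nonNeg s {{ℚ.nonNegative (ℚ.<⇒≤ 0<s)}}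

  U-inh : ∃ U′
  U-inh with X.L-rounded 0<x
  ... | s , 0<s , Ls with divide (1ℚ ℚ.+ 1ℚ) s 0<s
  ...   | q , qs≡2 = q , s , Ls , 0<s ,
          subst (1ℚ ℚ.<_) (sym qs≡2) (ℚ.+-monoʳ-< 1ℚ {0ℚ} {1ℚ} (ℚ.positive⁻¹ 1ℚ))

  L-rnd : ∀ {q} → L′ q → ∃[ r ] q ℚ.< r × L′ r
  L-rnd (s , Us , qs<1) with ℚ.<-dense qs<1
  ... | p , qs<p , p<1 with divide p s (U⇒pos Us)
  ...   | r , refl = r , cancel-< (U⇒pos Us) qs<p , s , Us , p<1

  U-rnd : ∀ {q} → U′ q → ∃[ r ] r ℚ.< q × U′ r
  U-rnd (s , Ls , 0<s , 1<qs) with ℚ.<-dense 1<qs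
  ... | p , 1<p , p<qs with divide p s 0<s
  ...   | r , refl = r , cancel-< 0<s p<qs , s , Ls , 0<s , 1<p

  disj : ∀ {q} → L′ q → U′ q → ⊥
  disj {q} (r , Ur , qr<1) (s , Ls , 0<s , 1<qs) with q ℚ.≤? 0ℚ
  ... | yes q≤0 = ℚ.<-asym 1<qs (ℚ.≤-<-trans
          (subst (q ℚ.* s ℚ.≤_) (ℚ.*-zeroˡ s)
            (ℚ.*-monoʳ-≤-nonNeg s {{ℚ.nonNegative (ℚ.<⇒≤ 0<s)}} q≤0))
          (ℚ.positive⁻¹ 1ℚ))
  ... | no  q≰0 = ℚ.<-asym qr<1 (ℚ.<-trans 1<qs
          (ℚ.*-monoʳ-<-pos q {{ℚ.positive (ℚ.≰⇒> q≰0)}} (L<U Ls Ur)))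

  loc : ∀ {q r} → q ℚ.< r → L′ q ⊎ U′ r
  loc {q} {r} q<r with q ℚ.≤? 0ℚ
  ... | yes q≤0 = inj₁ (u , Uu , ℚ.≤-<-trans
          (subst (q ℚ.* u ℚ.≤_) (ℚ.*-zeroˡ u)
            (ℚ.*-monoʳ-≤-nonNeg u {{ℚ.nonNegative (ℚ.<⇒≤ (U⇒pos Uu))}} q≤0))
          (ℚ.positive⁻¹ 1ℚ))
    where
    u  = proj₁ X.U-inhabited
    Uu = proj₂ X.U-inhabited
  ... | no q≰0 = split
    where
    0<q = ℚ.≰⇒> q≰0
    0<r = ℚ.<-trans 0<q q<r

    split : L′ q ⊎ U′ r
    split with divide 1ℚ q 0<q | divide 1ℚ r 0<r
    ... | a , aq≡1 | b , br≡1 = go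
      where
      b<a : b ℚ.< a
      b<a with b ℚ.<? a
      ... | yes b<a = b<a
      ... | no  b≮a = ⊥-elim (ℚ.<-irrefl refl
              (subst₂ ℚ._<_ aq≡1 br≡1
                (ℚ.<-≤-trans (ℚ.*-monoʳ-<-pos a {{ℚ.positive 0<a}} q<r)
                  (ℚ.*-monoʳ-≤-nonNeg r {{ℚ.nonNegative (ℚ.<⇒≤ 0<r)}} (ℚ.≮⇒≥ b≮a)))))
        where
        0<a : 0ℚ ℚ.< a
        0<a = cancel-< 0<q (subst₂ ℚ._<_ (sym (ℚ.*-zeroˡ q)) (sym aq≡1) (ℚ.positive⁻¹ 1ℚ))

      0<b : 0ℚ ℚ.< b
      0<b = cancel-< 0<r (subst₂ ℚ._<_ (sym (ℚ.*-zeroˡ r)) (sym br≡1) (ℚ.positive⁻¹ 1ℚ))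

      go : L′ q ⊎ U′ r
      go with ℚ.<-dense b<a
      ... | c , b<c , c<a with ℚ.<-dense b<c
      ...   | d , b<d , d<c with X.located d<c
      ...     | inj₁ Ld = inj₂ (d , Ld , ℚ.<-trans 0<b b<d ,
                  subst₂ ℚ._<_ br≡1 (ℚ.*-comm d r)
                    (ℚ.*-monoˡ-<-pos r {{ℚ.positive 0<r}} b<d))
      ...     | inj₂ Uc = inj₁ (c , Uc ,
                  subst₂ ℚ._<_ (ℚ.*-comm c q) aq≡1
                    (ℚ.*-monoˡ-<-pos q {{ℚ.positive 0<q}} c<a))

fromℕ : ℕ → ℚ
fromℕ n = ℤ.+ n ℚ./ 1

-- The nonnegative real n-th root of a natural number a, n ≥ 1.  The cuts
-- generated by q ≤ 0 or qⁿ ≤ a, and by 0 ≤ q and a ≤ qⁿ, are made open.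
root : (n : ℕ) .{{_ : ℕ.NonZero n}} → ℕ → ℝ
root n@(suc n′) a = record
  { L = L′
  ; U = U′
  ; L-inhabited = ℚ.- 1ℚ , 0ℚ , ℚ.negative⁻¹ (ℚ.- 1ℚ) , inj₁ ℚ.≤-refl
  ; U-inhabited = U-inh
  ; L-lower   = λ { q<r (s , r<s , p) → s , ℚ.<-trans q<r r<s , p }
  ; U-upper   = λ { q<r (s , s<q , p) → s , ℚ.<-trans s<q q<r , p }
  ; L-rounded = λ { (s , q<s , p) → let r , q<r , r<s = ℚ.<-dense q<s in r , q<r , s , r<s , p }
  ; U-rounded = λ { (s , s<q , p) → let r , s<r , r<q = ℚ.<-dense s<q in r , r<q , s , s<r , p }
  ; disjoint  = λ {q} → disj {q}
  ; located   = loc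
  }
  where
  A : ℚ
  A = fromℕ a

  L′ U′ : ℚ → Set
  L′ q = ∃[ r ] q ℚ.< r × (r ℚ.≤ 0ℚ ⊎ r ^ n ℚ.≤ A)
  U′ q = ∃[ r ] r ℚ.< q × 0ℚ ℚ.≤ r × A ℚ.≤ r ^ n

  0≤A : 0ℚ ℚ.≤ A
  0≤A = ℚ.nonNegative⁻¹ A {{ℚ.normalize-nonNeg a 1}}

  ^-nonNeg : ∀ {r} k → 0ℚ ℚ.≤ r → 0ℚ ℚ.≤ r ^ k
  ^-nonNeg zero    _   = ℚ.nonNegative⁻¹ 1ℚ
  ^-nonNeg {r} (suc k) 0≤r = subst (ℚ._≤ r ℚ.* r ^ k) (ℚ.*-zeroˡ (r ^ k))
    (ℚ.*-monoʳ-≤-nonNeg (r ^ k) {{ℚ.nonNegative (^-nonNeg k 0≤r)}} 0≤r)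

  ^-mono-≤ : ∀ {q r} k → 0ℚ ℚ.≤ q → q ℚ.≤ r → q ^ k ℚ.≤ r ^ k
  ^-mono-≤ zero _ _ = ℚ.≤-refl
  ^-mono-≤ {q} {r} (suc k) 0≤q q≤r = ℚ.≤-trans
    (ℚ.*-monoʳ-≤-nonNeg (q ^ k) {{ℚ.nonNegative (^-nonNeg k 0≤q)}} q≤r)
    (ℚ.*-monoˡ-≤-nonNeg r {{ℚ.nonNegative (ℚ.≤-trans 0≤q q≤r)}} (^-mono-≤ k 0≤q q≤r))

  ^-pos : ∀ {r} k → 0ℚ ℚ.< r → 0ℚ ℚ.< r ^ k
  ^-pos zero    _   = ℚ.positive⁻¹ 1ℚ
  ^-pos {r} (suc k) 0<r = subst (ℚ._< r ℚ.* r ^ k) (ℚ.*-zeroˡ (r ^ k))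
    (ℚ.*-monoˡ-<-pos (r ^ k) {{ℚ.positive (^-pos k 0<r)}} 0<r)

  ^-mono-< : ∀ {q r} k → 0ℚ ℚ.≤ q → q ℚ.< r → q ^ suc k ℚ.< r ^ suc k
  ^-mono-< {q} {r} k 0≤q q<r = ℚ.≤-<-trans
    (ℚ.*-monoˡ-≤-nonNeg q {{ℚ.nonNegative 0≤q}} (^-mono-≤ k 0≤q (ℚ.<⇒≤ q<r)))
    (ℚ.*-monoˡ-<-pos (r ^ k) {{ℚ.positive (^-pos k (ℚ.≤-<-trans 0≤q q<r))}} q<r)

  1≤^ : ∀ {r} k → 1ℚ ℚ.≤ r → 1ℚ ℚ.≤ r ^ k
  1≤^ {r} k 1≤r = subst (ℚ._≤ r ^ k) (one k) (^-mono-≤ k (ℚ.nonNegative⁻¹ 1ℚ) 1≤r)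
    where
    one : ∀ k → 1ℚ ^ k ≡ 1ℚ
    one zero    = refl
    one (suc k) = trans (ℚ.*-identityˡ (1ℚ ^ k)) (one k)

  U-inh : ∃ U′
  U-inh = B ℚ.+ 1ℚ , B ,
      subst (ℚ._< B ℚ.+ 1ℚ) (ℚ.+-identityʳ B) (ℚ.+-monoʳ-< B {0ℚ} {1ℚ} (ℚ.positive⁻¹ 1ℚ)) ,
      ℚ.≤-trans (ℚ.nonNegative⁻¹ 1ℚ) 1≤B ,
      ℚ.≤-trans A≤B (subst (ℚ._≤ B ^ n) (ℚ.*-identityʳ B)
        (ℚ.*-monoˡ-≤-nonNeg B {{ℚ.nonNegative (ℚ.≤-trans (ℚ.nonNegative⁻¹ 1ℚ) 1≤B)}}
          (1≤^ n′ 1≤B)))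
    where
    B = A ℚ.+ 1ℚ
    1≤B : 1ℚ ℚ.≤ B
    1≤B = subst (ℚ._≤ B) (ℚ.+-identityˡ 1ℚ) (ℚ.+-monoˡ-≤ 1ℚ 0≤A)
    A≤B : A ℚ.≤ B
    A≤B = subst (ℚ._≤ B) (ℚ.+-identityʳ A) (ℚ.+-monoʳ-≤ A {0ℚ} {1ℚ} (ℚ.nonNegative⁻¹ 1ℚ))

  disj : ∀ {q} → L′ q → U′ q → ⊥
  disj (r , q<r , inj₁ r≤0)  (s , s<q , 0≤s , _) =
    ℚ.<-irrefl refl (ℚ.<-≤-trans (ℚ.≤-<-trans 0≤s (ℚ.<-trans s<q q<r)) r≤0)
  disj (r , q<r , inj₂ rⁿ≤A) (s , s<q , 0≤s , A≤sⁿ) =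
    ℚ.<-irrefl refl (ℚ.<-≤-trans (^-mono-< n′ 0≤s (ℚ.<-trans s<q q<r)) (ℚ.≤-trans rⁿ≤A A≤sⁿ))

  loc : ∀ {q r} → q ℚ.< r → L′ q ⊎ U′ r
  loc q<r with ℚ.<-dense q<r
  ... | s , q<s , s<r with ℚ.≤-total s 0ℚ | ℚ.≤-total (s ^ n) A
  ...   | inj₁ s≤0 | _          = inj₁ (s , q<s , inj₁ s≤0)
  ...   | inj₂ _   | inj₁ sⁿ≤A  = inj₁ (s , q<s , inj₂ sⁿ≤A)
  ...   | inj₂ 0≤s | inj₂ A≤sⁿ  = inj₂ (s , s<r , 0≤s , A≤sⁿ)

√5 : ℝ
√5 = root 2 5

ω : ℝ
ω = halfℝ (1ℚ +ℝ √5)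

0<ω : L ω 0ℚ
0<ω = 0ℚ , ℚ.negative⁻¹ (ℚ.- 1ℚ) , inj₁ ℚ.≤-refl

ω⁻¹ : ℝ
ω⁻¹ = recip ω 0<ω

-- limsup a = inf_N sup_{n ≥ N} a n need not be a located cut, so it is
-- given by its (open) upper cut; q lies in it iff limsup a < q.
limsup : (ℕ → ℝ) → ℚ → Set
limsup a q = ∃[ r ] r ℚ.< q × (∃[ N ] ∀ n → N ℕ.≤ n → U (a n) r)

infix 4 _<ᵁ_
_<ᵁ_ : (ℚ → Set) → ℝ → Set
V <ᵁ y = ∃[ q ] V q × L y q

record ℚ[i] : Set where
  constructor _+i_
  field
    re im : ℚ

infixl 6 _⊕_ _⊖_
infixl 7 _⊗_
infixr 8 _↑_

_⊕_ _⊖_ _⊗_ : ℚ[i] → ℚ[i] → ℚ[i]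
(a +i b) ⊕ (c +i d) = (a ℚ.+ c) +i (b ℚ.+ d)
(a +i b) ⊖ (c +i d) = (a ℚ.- c) +i (b ℚ.- d)
(a +i b) ⊗ (c +i d) = (a ℚ.* c ℚ.- b ℚ.* d) +i (a ℚ.* d ℚ.+ b ℚ.* c)

_↑_ : ℚ[i] → ℕ → ℚ[i]
z ↑ zero  = 1ℚ +i 0ℚ
z ↑ suc n = z ⊗ z ↑ n

normSq : ℚ[i] → ℚ
normSq (a +i b) = a ℚ.* a ℚ.+ b ℚ.* b

Eventually : (ℕ → Set) → Set
Eventually P = ∃[ K ] ∀ k → K ℕ.≤ k → P k

-- The completion of ℚ(i); normSq being |·|², bounds on moduli are squared.
record ℂ : Set where
  field
    approx : ℕ → ℚ[i]
    cauchy : ∀ ε → 0ℚ ℚ.< ε → ∃[ K ] ∀ j k → K ℕ.≤ j → K ℕ.≤ k →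
             normSq (approx j ⊖ approx k) ℚ.≤ ε ℚ.* ε

open ℂ public using (approx)

infix 4 ∣_∣<_
∣_∣<_ : ℂ → ℝ → Set
∣ z ∣< R = ∃[ ρ ] 0ℚ ℚ.≤ ρ × L R ρ × Eventually (λ k → normSq (approx z k) ℚ.≤ ρ ℚ.* ρ)

-- Σ_{3 ≤ g < 3 + n} c g zᵍ.
partialSum : (ℕ → ℕ) → ℚ[i] → ℕ → ℚ[i]
partialSum c z zero    = 0ℚ +i 0ℚ
partialSum c z (suc n) =
  partialSum c z n ⊕ (fromℕ (c (3 ℕ.+ n)) +i 0ℚ) ⊗ z ↑ (3 ℕ.+ n)

-- The series Σ_{g ≥ 3} c g zᵍ converges to some w in ℂ.  Ring operations on
-- ℂ act termwise on approximating sequences, so the n-th partial sum at z is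
-- represented by λ k → partialSum c (approx z k) n.
SeriesConvergesAt : (ℕ → ℕ) → ℂ → Set
SeriesConvergesAt c z = Σ[ w ∈ ℂ ] (∀ ε → 0ℚ ℚ.< ε → Eventually λ n →
  Eventually λ k → normSq (partialSum c (approx z k) n ⊖ approx w k) ℚ.≤ ε ℚ.* ε)

{-# OPTIONS --safe #-}
module Submission where

-- A composition with parts in {1,2,3} and last part x_ℓ = 3 satisfies the second
-- Kunz condition automatically.  Read it as the word of pairs
-- p_t = (x_{t+1}, x_{ℓ-1-t}), t < ℓ/2: since x_ℓ = 3, no pair is (1,1).  If
-- x_{i+1} = 1 is the first 1 among the left letters, the first Kunz condition
-- with this part says x_{s+i+1} ≤ x_s + 1, which restricts the passage from p_t
-- to p_{t+i+1} on both sides.  So the word splits into i+1 interleaved chains,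
-- all but one starting with a left letter ≠ 1.  Give a letter a the weight
-- (5/8)^a, where 5/8 > 1/ω; a potential on the nine pairs shows that every chain
-- has total weight at most 1, whence c̃_g (5/8)^g ≤ (g+1)², the choices of ℓ and i.
-- The growth rate of c̃ is therefore at most 8/5 < ω.

-- Excluding the pair (1,1) alone does not reach ω: with letter weights (1/ω)^a the other eight
-- pairs sum to about 1.15. This is why the first left 1 has to be exploited; pairs whose left
-- letter is 2 or 3 sum to only 0.80, even at weight 5/8. The lag i + 1 depends on the word and is
-- unbounded, so no fixed finite transfer matrix describes whole words; but each of the interleaved
-- chains obeys one and the same one-step rule. Since the number of chains is unbounded as well, a
-- bound C > 1 per chain would cost C^(i+1). Hence the potential of the initial states must be at
-- most 1, and this limits the weight: at 5/8 the step inequality for a chain that starts with a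
-- left letter 2 or 3 reads 0.9943 ≤ 1.

open import Defs
open import Data.Nat.Base using (ℕ; suc)
open import Data.Product.Base using (Σ-syntax; _×_; _,_; proj₁; proj₂)

-- Kunz coordinates: semigroups with Frobenius number 3m - 1 as compositions

module KunzCoordinates where

  open import Data.Nat
  open import Data.Nat.Properties
  open import Data.Nat.DivMod
  open import Data.Nat.Divisibility using (divides-refl)
  open import Data.Nat.ListAction using (sum)
  open import Data.Nat.Solver using (module +-*-Solver)
  open import Data.Empty using (⊥-elim)
  open import Data.List.Base using (List; []; _∷_; _++_; length; map; concat; applyUpTo; upTo; foldr)
  open import Data.List.Properties using (length-applyUpTo; length-++; length-map; length-upTo)
  open import Data.List.Membership.Propositional using () renaming (_∈_ to _∈ˡ_)
  open import Data.List.Membership.Propositional.Properties using (∈-map⁻; ∈-map⁺; ∈-concat⁻′; ∈-concat⁺′; ∈-applyUpTo⁺; ∈-applyUpTo⁻; ∈-upTo⁺; ∈-upTo⁻; ∈-∃++; ∈-++⁺ˡ; ∈-++⁺ʳ; ∈-++⁻)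
  open import Data.List.Relation.Unary.All as All using (All; []; _∷_)
  import Data.List.Relation.Unary.All.Properties as All
  open import Data.List.Relation.Unary.AllPairs using ([]; _∷_)
  import Data.List.Relation.Unary.AllPairs.Properties as AllPairs
  open import Data.List.Relation.Unary.Any using (here; there)
  open import Data.List.Relation.Unary.Unique.Propositional using (Unique)
  import Data.List.Relation.Unary.Unique.Propositional.Properties as Unique
  open import Data.Product.Base using (_×_; _,_; proj₁; proj₂)
  open import Data.Sum.Base using (inj₁; inj₂)
  open import Function.Base using (_∘_; id)
  open import Function.Bundles using (Inverse; _⇔_; mk⇔; Equivalence)
  open import Relation.Binary.PropositionalEquality
  open import Relation.Nullary using (¬_; yes; no)
  open import Relation.Unary using (_≐_; _∈_)
  open import Relation.Unary.Relation.Binary.Equality using (≐-setoid)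
  open import Relation.Binary.Bundles using (Setoid)
  open import Level using (0ℓ)

  part-zero : ∀ xs → part xs 0 ≡ 0
  part-zero []       = refl
  part-zero (x ∷ xs) = refl

  applyUpTo-part : ∀ xs → applyUpTo (part xs ∘ suc) (length xs) ≡ xs
  applyUpTo-part []       = refl
  applyUpTo-part (x ∷ xs) = cong (x ∷_) (applyUpTo-part xs)

  part-applyUpTo : ∀ f n r → r < n → part (applyUpTo f n) (suc r) ≡ f r
  part-applyUpTo f (suc n) zero    _         = refl
  part-applyUpTo f (suc n) (suc r) (s≤s r<n) = part-applyUpTo (f ∘ suc) n r r<n

  All⇒part : ∀ {P : ℕ → Set} {xs} → All P xs → ∀ {r} → 1 ≤ r → r ≤ length xs → P (part xs r)
  All⇒part {P} {xs} ps {suc r} _ r<n = go ps r<n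
    where
    go : ∀ {xs r} → All P xs → r < length xs → P (part xs (suc r))
    go {r = zero}  (p ∷ ps) _         = p
    go {r = suc r} (p ∷ ps) (s≤s r<n) = go ps r<n

  part≤maximum : ∀ xs r → part xs r ≤ foldr _⊔_ 0 xs
  part≤maximum []       r             = z≤n
  part≤maximum (x ∷ xs) zero          = z≤n
  part≤maximum (x ∷ xs) (suc zero)    = m≤m⊔n x _
  part≤maximum (x ∷ xs) (suc (suc r)) = ≤-trans (part≤maximum xs (suc r)) (m≤n⊔m x _)

  part-ext : ∀ xs ys → length xs ≡ length ys →
             (∀ r → 1 ≤ r → r ≤ length xs → part xs r ≡ part ys r) → xs ≡ ys
  part-ext []       []       _  _  = refl
  part-ext (x ∷ xs) (y ∷ ys) eq eqs = cong₂ _∷_ (eqs 1 ≤-refl (s≤s z≤n))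
    (part-ext xs ys (suc-injective eq) λ { (suc r) _ r≤n → eqs (suc (suc r)) (s≤s z≤n) (s≤s r≤n) })

  [r+km]%m≡r : ∀ {r m} k .{{_ : NonZero m}} → r < m → (r + k * m) % m ≡ r
  [r+km]%m≡r {r} {m} k r<m = trans ([m+kn]%n≡m%n r k m) (m<n⇒m%n≡m r<m)

  [r+km]/m≡k : ∀ {r m} k .{{_ : NonZero m}} → r < m → (r + k * m) / m ≡ k
  [r+km]/m≡k {r} {m} k r<m =
    trans (+-distrib-/-∣ʳ r (divides-refl k)) (cong₂ _+_ (m<n⇒m/n≡0 r<m) (m*n/n≡m k m))

  -- r + k m with r < m is an element iff x_r ≤ k, where x_0 = part xs 0 = 0.
  KunzSet : List ℕ → ℕ → Set
  KunzSet xs n = part xs (n % suc (length xs)) ≤ n / suc (length xs)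

  kunzSet-≡ : ∀ xs {r} k → r < suc (length xs) →
              KunzSet xs (r + k * suc (length xs)) ≡ (part xs r ≤ k)
  kunzSet-≡ xs k r<m = cong₂ (λ a b → part xs a ≤ b) ([r+km]%m≡r k r<m) ([r+km]/m≡k k r<m)

  unique-⊆⇒length≤ : ∀ {a} {A : Set a} {xs ys : List A} → Unique xs → (∀ {x} → x ∈ˡ xs → x ∈ˡ ys) →
                    length xs ≤ length ys
  unique-⊆⇒length≤ {xs = []} _ _ = z≤n
  unique-⊆⇒length≤ {xs = x ∷ xs} (x∉ ∷ u) xs⊆ys with ∈-∃++ (xs⊆ys (here refl))
  ... | as , bs , refl = subst (suc (length xs) ≤_) (sym len)
          (s≤s (subst (length xs ≤_) (length-++ as) (unique-⊆⇒length≤ u rest)))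
    where
    len : length (as ++ x ∷ bs) ≡ suc (length as + length bs)
    len = trans (length-++ as) (+-suc (length as) (length bs))
    rest : ∀ {y} → y ∈ˡ xs → y ∈ˡ as ++ bs
    rest y∈ with ∈-++⁻ as (xs⊆ys (there y∈))
    ... | inj₁ y∈as         = ∈-++⁺ˡ y∈as
    ... | inj₂ (here refl)  = ⊥-elim (All.lookup x∉ y∈ refl)
    ... | inj₂ (there y∈bs) = ∈-++⁺ʳ as y∈bs

  -- `genus` reads the stored list of gaps, which the carrier determines only up to order;
  -- repetition-free lists with the same members have the same length.
  genus-cong : ∀ S T → Carrier S ≐ Carrier T → genus S ≡ genus T
  genus-cong S T (S⊆T , T⊆S) = ≤-antisym (le S T T⊆S) (le T S S⊆T)
    where
    open NumericalSemigroup
    le : ∀ S T → (∀ {n} → Carrier T n → Carrier S n) → genus S ≤ genus T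
    le S T T⊆S = unique-⊆⇒length≤ (gaps-unique S) λ {n} n∈ →
      Equivalence.from (gaps-spec T n) (Equivalence.to (gaps-spec S n) n∈ ∘ T⊆S)

  multiplicity-unique : ∀ S T {m n} → Carrier S ≐ Carrier T →
                        IsMultiplicity S m → IsMultiplicity T n → m ≡ n
  multiplicity-unique _ _ (S⊆T , T⊆S) (m∈ , m≢0 , m-min) (n∈ , n≢0 , n-min) =
    ≤-antisym (m-min _ (T⊆S n∈) n≢0) (n-min _ (S⊆T m∈) m≢0)

  module FromComposition (C : NSGComposition) where
    open NSGComposition C using (m; x; positive; kunz₁; kunz₂)

    private
      xs : List ℕ
      xs = parts C
      ℓ : ℕ
      ℓ = length xs

    kunz₁′ : ∀ s t → s + t < m → x (s + t) ≤ x s + x t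
    kunz₁′ zero    t       _  = m≤n+m (x t) (x 0)
    kunz₁′ (suc s) zero    _  = subst (λ k → x k ≤ x (suc s) + x 0) (sym (+-identityʳ (suc s))) (m≤m+n _ _)
    kunz₁′ (suc s) (suc t) st = kunz₁ (suc s) (suc t) (s≤s z≤n) (s≤s z≤n) st

    -- Replacing s and t by m - s and m - t turns the second Kunz condition into one on residues
    -- whose sum wraps around m; the summand 1 is the carry.
    kunz₂′ : ∀ s t u → s < m → t < m → s + t ≡ u + m → x u ≤ suc (x s + x t)
    kunz₂′ s t zero      _   _   _  = subst (_≤ suc (x s + x t)) (sym (part-zero xs)) z≤n
    kunz₂′ s t u@(suc _) s<m t<m eq = subst₂ _≤_ (cong x lhs)
        (trans (cong₂ (λ a b → x a + x b + 1) (m∸[m∸n]≡n (<⇒≤ s<m)) (m∸[m∸n]≡n (<⇒≤ t<m))) (+-comm (x s + x t) 1))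
        (kunz₂ (m ∸ s) (m ∸ t) (m<n⇒0<n∸m s<m) (m<n⇒0<n∸m t<m) bound)
      where
      s-eq : s ≡ (m ∸ t) + u
      s-eq = +-cancelʳ-≡ t s ((m ∸ t) + u) (begin
        s + t             ≡⟨ eq ⟩
        u + m             ≡⟨ cong (u +_) (m∸n+n≡m (<⇒≤ t<m)) ⟨
        u + (m ∸ t + t)   ≡⟨ +-assoc u (m ∸ t) t ⟨
        u + (m ∸ t) + t   ≡⟨ cong (_+ t) (+-comm u (m ∸ t)) ⟩
        m ∸ t + u + t     ∎)
        where open ≡-Reasoning
      lhs : m ∸ (m ∸ s) ∸ (m ∸ t) ≡ u
      lhs = begin
        m ∸ (m ∸ s) ∸ (m ∸ t)      ≡⟨ cong (_∸ (m ∸ t)) (m∸[m∸n]≡n (<⇒≤ s<m)) ⟩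
        s ∸ (m ∸ t)                ≡⟨ cong (_∸ (m ∸ t)) s-eq ⟩
        (m ∸ t) + u ∸ (m ∸ t)      ≡⟨ m+n∸m≡n (m ∸ t) u ⟩
        u                          ∎
        where open ≡-Reasoning
      bound : (m ∸ s) + (m ∸ t) < m
      bound = begin-strict
        (m ∸ s) + (m ∸ t)        <⟨ +-monoʳ-< (m ∸ s) (m<m+n (m ∸ t) (s≤s z≤n)) ⟩
        (m ∸ s) + ((m ∸ t) + u)  ≡⟨ cong ((m ∸ s) +_) s-eq ⟨
        (m ∸ s) + s              ≡⟨ m∸n+n≡m (<⇒≤ s<m) ⟩
        m                        ∎
        where open ≤-Reasoning

    -- Quotients by m add up, with a carry exactly when the residues sum to at least m. The two
    -- cases are the two Kunz conditions.
    closed : ∀ {a b} → KunzSet xs a → KunzSet xs b → KunzSet xs (a + b)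
    closed {a} {b} a∈ b∈ with suc (s + t) ≤? m
      where
      s = a % m
      t = b % m
    ... | yes st<m = subst (KunzSet xs) (sym eq)
                       (subst id (sym (kunzSet-≡ xs (a / m + b / m) st<m))
                         (≤-trans (kunz₁′ (a % m) (b % m) st<m) (+-mono-≤ a∈ b∈)))
      where
      eq : a + b ≡ a % m + b % m + (a / m + b / m) * m
      eq = trans (cong₂ _+_ (m≡m%n+[m/n]*n a m) (m≡m%n+[m/n]*n b m))
        (solve 5 (λ s k t l m → s :+ k :* m :+ (t :+ l :* m) := s :+ t :+ (k :+ l) :* m) refl
          (a % m) (a / m) (b % m) (b / m) m)
        where open +-*-Solver
    ... | no  st≮m = subst (KunzSet xs) (sym eq)
                       (subst id (sym (kunzSet-≡ xs (suc (a / m + b / m)) u<m))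
                         (≤-trans (kunz₂′ (a % m) (b % m) u (m%n<n a m) (m%n<n b m) st-eq) (s≤s (+-mono-≤ a∈ b∈))))
      where
      m≤st = s≤s⁻¹ (≰⇒> st≮m)
      u = a % m + b % m ∸ m
      st-eq : a % m + b % m ≡ u + m
      st-eq = sym (m∸n+n≡m m≤st)
      u<m : u < m
      u<m = +-cancelʳ-< m u m (subst (_< m + m) st-eq (+-mono-< (m%n<n a m) (m%n<n b m)))
      eq : a + b ≡ u + suc (a / m + b / m) * m
      eq = trans (trans (cong₂ _+_ (m≡m%n+[m/n]*n a m) (m≡m%n+[m/n]*n b m))
        (trans (solve 5 (λ s k t l m → s :+ k :* m :+ (t :+ l :* m) := s :+ t :+ (k :+ l) :* m) refl
          (a % m) (a / m) (b % m) (b / m) m) (cong (_+ (a / m + b / m) * m) st-eq))) (+-assoc u m _)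
        where open +-*-Solver

    row : ℕ → List ℕ
    row r = map (λ k → r + k * m) (upTo (x r))

    ∈-row⇒% : ∀ {n r} → r < m → n ∈ˡ row r → n % m ≡ r × n / m < x r
    ∈-row⇒% r<m n∈ with ∈-map⁻ _ n∈
    ... | k , k∈ , refl = [r+km]%m≡r k r<m , subst (_< x _) (sym ([r+km]/m≡k k r<m)) (∈-upTo⁻ k∈)

    gapList : List ℕ
    gapList = concat (applyUpTo row m)

    gapList-unique : Unique gapList
    gapList-unique = Unique.concat⁺
      (All.applyUpTo⁺₂ row m λ r →
        Unique.map⁺ (λ {k} {l} eq → *-cancelʳ-≡ k l m (+-cancelˡ-≡ r (k * m) (l * m) eq)) (Unique.upTo⁺ (x r)))
      (AllPairs.applyUpTo⁺₁ row m λ {i} {j} i<j j<m (n∈i , n∈j) →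
        <-irrefl (trans (sym (proj₁ (∈-row⇒% (<-trans i<j j<m) n∈i))) (proj₁ (∈-row⇒% j<m n∈j))) i<j)

    gapList-spec : ∀ n → n ∈ˡ gapList ⇔ (¬ KunzSet xs n)
    gapList-spec n = mk⇔ to from
      where
      to : n ∈ˡ gapList → ¬ KunzSet xs n
      to n∈ n∈S with ∈-concat⁻′ (applyUpTo row m) n∈
      ... | _ , n∈row , row∈ with ∈-applyUpTo⁻ row row∈
      ... | r , r<m , refl with ∈-row⇒% r<m n∈row
      ... | refl , n/m<x = <-irrefl refl (<-≤-trans n/m<x n∈S)
      from : ¬ KunzSet xs n → n ∈ˡ gapList
      from n∉S = ∈-concat⁺′
        (subst (_∈ˡ row (n % m)) (sym (m≡m%n+[m/n]*n n m)) (∈-map⁺ _ (∈-upTo⁺ (≰⇒> n∉S))))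
        (∈-applyUpTo⁺ row (m%n<n n m))

    -- The residue class of r contributes x_r gaps, and the class of 0 none, its coordinate being 0.
    length-gapList : length gapList ≡ compositionGenus C
    length-gapList = begin
      length (concat (applyUpTo row m))     ≡⟨ go m ⟩
      sum (applyUpTo x m)                   ≡⟨ cong (_+ sum (applyUpTo (x ∘ suc) ℓ)) (part-zero xs) ⟩
      sum (applyUpTo (x ∘ suc) ℓ)           ≡⟨ cong sum (applyUpTo-part xs) ⟩
      sum xs                                ∎
      where
      open ≡-Reasoning
      go′ : ∀ f n → length (concat (applyUpTo (row ∘ f) n)) ≡ sum (applyUpTo (x ∘ f) n)
      go′ f zero    = refl
      go′ f (suc n) = trans (length-++ (row (f 0)))
        (cong₂ _+_ (trans (length-map _ (upTo (x (f 0)))) (length-upTo (x (f 0)))) (go′ (f ∘ suc) n))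
      go = go′ id

    semigroup : NumericalSemigroup
    semigroup = record
      { Carrier     = KunzSet xs
      ; carrier?    = λ n → part xs (n % m) ≤? n / m
      ; 0∈          = subst id (sym (kunzSet-≡ xs 0 (s≤s z≤n))) (≤-reflexive (part-zero xs))
      ; +-closed    = λ {a} {b} → closed {a} {b}
      ; gaps        = gapList
      ; gaps-unique = gapList-unique
      ; gaps-spec   = gapList-spec
      }

    isMultiplicity : IsMultiplicity semigroup m
    isMultiplicity = subst (KunzSet xs) (+-identityʳ m)
        (subst id (sym (kunzSet-≡ xs 1 (s≤s z≤n))) (≤-trans (≤-reflexive (part-zero xs)) z≤n))
      , (λ ()) , λ n n∈ n≢0 → ≮⇒≥ λ n<m → small n n∈ n≢0 n<m
      where
      small : ∀ n → KunzSet xs n → n ≢ 0 → ¬ (n < m)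
      small zero    _  n≢0 _   = n≢0 refl
      small (suc n) n∈ _   n<m = <-irrefl refl (≤-trans (All⇒part positive (s≤s z≤n) (s≤s⁻¹ n<m))
        (subst id (kunzSet-≡ xs 0 n<m) (subst (KunzSet xs) (sym (+-identityʳ (suc n))) n∈)))

    -- 3m - 1 = (m - 1) + 2m lies in the class of the last part, and 3 > 2 makes it a gap. From 3m
    -- on the quotient is at least 3, which bounds every part.
    isFrobenius : maximum C ≡ 3 → x (m ∸ 1) ≡ 3 → IsFrobenius semigroup (3 * m ∸ 1)
    isFrobenius max≡3 last≡3 = (λ f∈ → <-irrefl refl (subst (_≤ 2) last≡3
        (subst id (kunzSet-≡ xs 2 ≤-refl) f∈)))
      , λ n n∉ → s≤s⁻¹ (≰⇒> λ 3m≤n → n∉ (begin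
          x (n % m)     ≤⟨ part≤maximum xs (n % m) ⟩
          maximum C     ≡⟨ max≡3 ⟩
          3             ≡⟨ m*n/n≡m 3 m ⟨
          3 * m / m     ≤⟨ /-monoˡ-≤ m 3m≤n ⟩
          n / m         ∎))
      where open ≤-Reasoning

  module FromSemigroup (S : NumericalSemigroup) (n : ℕ)
    (isMult : IsMultiplicity S (suc n)) (isFrob : IsFrobenius S (3 * suc n ∸ 1)) where
    open NumericalSemigroup S using (carrier?; 0∈; +-closed)

    private
      μ : ℕ
      μ = suc n

    -- The least k with r + k m in S, which is at most 3 as everything from 3 m on is in S.
    coord : ℕ → ℕ
    coord r with carrier? (r + 0 * μ) | carrier? (r + 1 * μ) | carrier? (r + 2 * μ)
    ... | yes _ | _     | _     = 0
    ... | no _  | yes _ | _     = 1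
    ... | no _  | no _  | yes _ = 2
    ... | no _  | no _  | no _  = 3

    +μ-closed : ∀ r k → r + k * μ ∈ Carrier S → r + suc k * μ ∈ Carrier S
    +μ-closed r k ∈S = subst (Carrier S)
      (solve 3 (λ r k m → r :+ k :* m :+ m := r :+ (m :+ k :* m)) refl r k μ)
      (+-closed ∈S (proj₁ isMult))
      where open +-*-Solver

    ≥-closed : ∀ r {k l} → k ≤ l → r + k * μ ∈ Carrier S → r + l * μ ∈ Carrier S
    ≥-closed r {k} k≤l ∈S = go (≤⇒≤′ k≤l)
      where
      go : ∀ {l} → k ≤′ l → r + l * μ ∈ Carrier S
      go ≤′-refl           = ∈S
      go (≤′-step {l} k≤l) = +μ-closed r l (go k≤l)

    3μ≤⇒∈ : ∀ {a} → 3 * μ ≤ a → a ∈ Carrier S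
    3μ≤⇒∈ {a} 3μ≤a with carrier? a
    ... | yes a∈ = a∈
    ... | no  a∉ = ⊥-elim (<-irrefl refl (≤-trans 3μ≤a (proj₂ isFrob a a∉)))

    -- Together with `∈⇒coord-≤` this makes `coord r ≤ k` equivalent to r + kμ ∈ S. All inequalities
    -- between coordinates below come from closure of S through this equivalence.
    coord-≤⇒∈ : ∀ r k → coord r ≤ k → r + k * μ ∈ Carrier S
    coord-≤⇒∈ r k le with carrier? (r + 0 * μ) | carrier? (r + 1 * μ) | carrier? (r + 2 * μ)
    ... | yes p | _     | _     = ≥-closed r le p
    ... | no _  | yes p | _     = ≥-closed r le p
    ... | no _  | no _  | yes p = ≥-closed r le p
    ... | no _  | no _  | no _  = ≥-closed r le (3μ≤⇒∈ (m≤n+m (3 * μ) r))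

    ∈⇒coord-≤ : ∀ r k → r + k * μ ∈ Carrier S → coord r ≤ k
    ∈⇒coord-≤ r k ∈S with carrier? (r + 0 * μ) | carrier? (r + 1 * μ) | carrier? (r + 2 * μ)
    ... | yes _ | _     | _     = z≤n
    ... | no p  | yes _ | _     = ≰⇒> λ k≤0 → p (≥-closed r k≤0 ∈S)
    ... | no _  | no p  | yes _ = ≰⇒> λ k≤1 → p (≥-closed r k≤1 ∈S)
    ... | no _  | no _  | no p  = ≰⇒> λ k≤2 → p (≥-closed r k≤2 ∈S)

    coord-∈ : ∀ r → r + coord r * μ ∈ Carrier S
    coord-∈ r = coord-≤⇒∈ r (coord r) ≤-refl

    coord≤3 : ∀ r → coord r ≤ 3
    coord≤3 r = ∈⇒coord-≤ r 3 (3μ≤⇒∈ (m≤n+m (3 * μ) r))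

    coord-zero : coord 0 ≡ 0
    coord-zero = n≤0⇒n≡0 (∈⇒coord-≤ 0 0 0∈)

    coord-positive : ∀ {r} → suc r < μ → 1 ≤ coord (suc r)
    coord-positive {r} r<μ = ≰⇒> λ c≤0 → <⇒≱ r<μ
      (proj₂ (proj₂ isMult) (suc r) (subst (Carrier S) (+-identityʳ (suc r)) (coord-≤⇒∈ (suc r) 0 c≤0)) λ ())

    coord-last : coord n ≡ 3
    coord-last = ≤-antisym (coord≤3 n) (≰⇒> λ c≤2 → proj₁ isFrob (coord-≤⇒∈ n 2 c≤2))

    xs : List ℕ
    xs = applyUpTo (coord ∘ suc) n

    length-xs : length xs ≡ n
    length-xs = length-applyUpTo (coord ∘ suc) n

    part-xs : ∀ r → r ≤ n → part xs r ≡ coord r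
    part-xs zero    _   = trans (part-zero xs) (sym coord-zero)
    part-xs (suc r) r<n = part-applyUpTo (coord ∘ suc) n r r<n

    coord-subadditive : ∀ s t → coord (s + t) ≤ coord s + coord t
    coord-subadditive s t = ∈⇒coord-≤ (s + t) (coord s + coord t)
      (subst (Carrier S) eq (+-closed (coord-∈ s) (coord-∈ t)))
      where
      open +-*-Solver
      eq = solve 5 (λ s k t l m → s :+ k :* m :+ (t :+ l :* m) := s :+ t :+ (k :+ l) :* m) refl
             s (coord s) t (coord t) μ

    coord-subadditive-wrap : ∀ s t u → s + t ≡ u + μ → coord u ≤ coord s + coord t + 1
    coord-subadditive-wrap s t u eq = ∈⇒coord-≤ u (coord s + coord t + 1)
      (subst (Carrier S) eq′ (+-closed (coord-∈ s) (coord-∈ t)))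
      where
      open +-*-Solver
      eq′ : s + coord s * μ + (t + coord t * μ) ≡ u + (coord s + coord t + 1) * μ
      eq′ = trans (solve 5 (λ s k t l m → s :+ k :* m :+ (t :+ l :* m) := s :+ t :+ (k :+ l) :* m) refl
                     s (coord s) t (coord t) μ)
           (trans (cong (_+ (coord s + coord t) * μ) eq)
                  (solve 4 (λ u m k l → u :+ m :+ (k :+ l) :* m := u :+ (k :+ l :+ con 1) :* m) refl
                     u μ (coord s) (coord t)))

    maximum-xs : foldr _⊔_ 0 xs ≡ 3
    maximum-xs = ≤-antisym (bound (coord≤3 ∘ suc) n)
      (subst (_≤ foldr _⊔_ 0 xs) (trans (part-xs n ≤-refl) coord-last) (part≤maximum xs n))
      where
      bound : ∀ {f : ℕ → ℕ} {b} → (∀ i → f i ≤ b) → ∀ k → foldr _⊔_ 0 (applyUpTo f k) ≤ b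
      bound f≤b zero    = z≤n
      bound f≤b (suc k) = ⊔-lub (f≤b 0) (bound (f≤b ∘ suc) k)

    composition : NSGComposition
    composition = record
      { parts    = xs
      ; positive = All.applyUpTo⁺₁ (coord ∘ suc) n λ i<n → coord-positive (s≤s i<n)
      ; kunz₁    = λ s t _ _ st<m → let st≤n = subst (s + t ≤_) length-xs (s≤s⁻¹ st<m) in
          subst₂ _≤_ (sym (part-xs (s + t) st≤n))
            (sym (cong₂ _+_ (part-xs s (≤-trans (m≤m+n s t) st≤n)) (part-xs t (≤-trans (m≤n+m t s) st≤n))))
            (coord-subadditive s t)
      ; kunz₂    = λ s t 1≤s 1≤t st<m → kunz₂ s t 1≤s 1≤t
          (subst (λ k → s + t < suc k) length-xs st<m)
      }
      where
      kunz₂ : ∀ s t → 1 ≤ s → 1 ≤ t → s + t < μ →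
              part xs (suc (length xs) ∸ s ∸ t) ≤ part xs (suc (length xs) ∸ s) + part xs (suc (length xs) ∸ t) + 1
      kunz₂ (suc s) (suc t) _ _ st<μ rewrite length-xs = subst₂ _≤_
          (sym (part-xs (n ∸ s ∸ suc t) (≤-trans (m∸n≤m (n ∸ s) (suc t)) (m∸n≤m n s))))
          (sym (cong (_+ 1) (cong₂ _+_ (part-xs (n ∸ s) (m∸n≤m n s)) (part-xs (n ∸ t) (m∸n≤m n t)))))
          (coord-subadditive-wrap (n ∸ s) (n ∸ t) (n ∸ s ∸ suc t) (begin
            n ∸ s + (n ∸ t)                       ≡⟨ cong (_+ (n ∸ t)) (m∸n+n≡m t<n-s) ⟨
            n ∸ s ∸ suc t + suc t + (n ∸ t)       ≡⟨ +-assoc (n ∸ s ∸ suc t) (suc t) (n ∸ t) ⟩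
            n ∸ s ∸ suc t + suc (t + (n ∸ t))     ≡⟨ cong (λ k → n ∸ s ∸ suc t + suc k) (m+[n∸m]≡n t≤n) ⟩
            n ∸ s ∸ suc t + μ                     ∎))
        where
        open ≡-Reasoning
        s+t<n : s + suc t ≤ n
        s+t<n = s≤s⁻¹ (≤-trans (n≤1+n _) st<μ)
        t<n-s : suc t ≤ n ∸ s
        t<n-s = m+n≤o⇒m≤o∸n (suc t) (subst (_≤ n) (+-comm s (suc t)) s+t<n)
        t≤n : t ≤ n
        t≤n = ≤-trans (n≤1+n t) (≤-trans (m≤n+m (suc t) s) s+t<n)

    last-composition : NSGComposition.x composition (NSGComposition.m composition ∸ 1) ≡ 3
    last-composition = trans (cong (part xs) length-xs) (trans (part-xs n ≤-refl) coord-last)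

    kunzSet≐ : KunzSet xs ≐ Carrier S
    kunzSet≐ rewrite length-xs = to , from
      where
      to : ∀ {a} → part xs (a % μ) ≤ a / μ → Carrier S a
      to {a} p = subst (Carrier S) (sym (m≡m%n+[m/n]*n a μ))
        (coord-≤⇒∈ (a % μ) (a / μ) (subst (_≤ a / μ) (part-xs (a % μ) (s≤s⁻¹ (m%n<n a μ))) p))
      from : ∀ {a} → Carrier S a → part xs (a % μ) ≤ a / μ
      from {a} a∈ = subst (_≤ a / μ) (sym (part-xs (a % μ) (s≤s⁻¹ (m%n<n a μ))))
        (∈⇒coord-≤ (a % μ) (a / μ) (subst (Carrier S) (m≡m%n+[m/n]*n a μ) a∈))

  -- The set determines m as its multiplicity, hence the number of parts, and x_r as the least k
  -- with r + km in it: testing k = x_r for either composition gives the two inequalities.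
  KunzSet-injective : ∀ C D → KunzSet (parts C) ≐ KunzSet (parts D) → parts C ≡ parts D
  KunzSet-injective C D eq@(C⊆D , D⊆C) = part-ext (parts C) (parts D) len λ r _ r≤ → ≤-antisym
      (le (parts D) (parts C) (sym len) (λ a → D⊆C {a}) r (subst (r ≤_) len r≤))
      (le (parts C) (parts D) len (λ a → C⊆D {a}) r r≤)
    where
    module C = FromComposition C
    module D = FromComposition D
    len : length (parts C) ≡ length (parts D)
    len = suc-injective (multiplicity-unique C.semigroup D.semigroup eq C.isMultiplicity D.isMultiplicity)
    le : ∀ xs ys → length xs ≡ length ys → (∀ a → KunzSet xs a → KunzSet ys a) →
         ∀ r → r ≤ length xs → part ys r ≤ part xs r
    le xs ys len xs⊆ys r r≤ = subst id (kunzSet-≡ ys (part xs r) (s≤s (subst (r ≤_) len r≤)))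
      (subst (λ k → KunzSet ys (r + part xs r * suc k)) len
        (xs⊆ys (r + part xs r * suc (length xs)) (subst id (sym (kunzSet-≡ xs (part xs r) (s≤s r≤))) ≤-refl)))

  -- Only the round trip on semigroups is computed; the one on compositions follows from it by
  -- `KunzSet-injective`. Multiplicity 0 is excluded by definition.
  compositions↔semigroups : ∀ g → Inverse (Compositions3 g) (Semigroups3m-1 g)
  compositions↔semigroups g = record
    { to        = to
    ; from      = from
    ; to-cong   = λ {C} {D} eq → subst (λ xs → KunzSet (parts (proj₁ C)) ≐ KunzSet xs) eq (id , id)
    ; from-cong = λ {S} {T} S≐T → KunzSet-injective (proj₁ (from S)) (proj₁ (from T))
        (≐.trans (to∘from S) (≐.trans S≐T (≐.sym (to∘from T))))
    ; inverse   = (λ { {S} refl → to∘from S })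
                , λ {C} {S} S≐C → KunzSet-injective (proj₁ (from S)) (proj₁ C) (≐.trans (to∘from S) S≐C)
    }
    where
    module Comp = Setoid (Compositions3 g)
    module Semi = Setoid (Semigroups3m-1 g)
    module ≐ = Setoid (≐-setoid ℕ 0ℓ)

    to : Comp.Carrier → Semi.Carrier
    to (C , genus≡ , max≡3 , last≡3) = semigroup , trans length-gapList genus≡ ,
      _ , isMultiplicity , isFrobenius max≡3 last≡3
      where open FromComposition C

    from : Semi.Carrier → Comp.Carrier
    from (S , genus≡ , zero  , (_ , 0≢0 , _) , _)  = ⊥-elim (0≢0 refl)
    from (S , genus≡ , suc n , isMult , isFrob) = composition ,
        trans (sym (FromComposition.length-gapList composition))
          (trans (genus-cong (FromComposition.semigroup composition) S kunzSet≐) genus≡) ,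
        maximum-xs , last-composition
      where open FromSemigroup S n isMult isFrob

    to∘from : ∀ S → KunzSet (parts (proj₁ (from S))) ≐ Carrier (proj₁ S)
    to∘from (S , genus≡ , zero  , (_ , 0≢0 , _) , _)  = ⊥-elim (0≢0 refl)
    to∘from (S , genus≡ , suc n , isMult , isFrob) = FromSemigroup.kunzSet≐ S n isMult isFrob

-- Finite enumeration of the compositions of genus g

module Enumeration where

  open import Data.Nat
  open import Data.Nat.Properties
  open import Data.Nat.ListAction using (sum)
  open import Data.Fin.Base using (zero; suc)
  open import Data.Empty using (⊥-elim)
  open import Data.List.Base using (List; []; _∷_; length; foldr; lookup; filter; concatMap; upTo; cartesianProductWith; deduplicate)
  open import Data.List.Properties using (≡-dec)
  open import Data.List.Membership.Propositional using () renaming (_∈_ to _∈ˡ_)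
  open import Data.List.Membership.Propositional.Properties using (∈-lookup; ∈-filter⁺; ∈-filter⁻; ∈-cartesianProductWith⁺; ∈-concatMap⁺; ∈-upTo⁺; ∈-deduplicate⁺)
  open import Data.List.Relation.Unary.All as All using (All; []; _∷_; all?)
  open import Data.List.Relation.Unary.AllPairs using ([]; _∷_)
  open import Data.List.Relation.Unary.Any as Any using (here; there; index)
  open import Data.List.Relation.Unary.Any.Properties using (lookup-index)
  open import Data.List.Relation.Unary.Unique.Propositional using (Unique)
  import Data.List.Relation.Unary.Unique.Propositional.Properties as Unique
  open import Data.List.Relation.Unary.Unique.DecPropositional.Properties (≡-dec _≟_) using (deduplicate-!)
  open import Data.Product.Base using (∃-syntax; _×_; _,_; proj₁; proj₂)
  open import Function.Base using (_∘_)
  open import Relation.Binary.PropositionalEquality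
  import Relation.Binary.Construct.On as On
  open import Relation.Nullary using (Dec)
  open import Relation.Nullary.Decidable using (map′; _×-dec_; _→-dec_)
  open KunzCoordinates

  lookup-injective : ∀ {a} {A : Set a} {xs : List A} → Unique xs → ∀ i j →
                     lookup xs i ≡ lookup xs j → i ≡ j
  lookup-injective (_ ∷ _) zero    zero    _  = refl
  lookup-injective {xs = x ∷ xs} (x∉ ∷ _) zero (suc j) eq = ⊥-elim (All.lookup x∉ (∈-lookup j) eq)
  lookup-injective {xs = x ∷ xs} (x∉ ∷ _) (suc i) zero eq = ⊥-elim (All.lookup x∉ (∈-lookup i) (sym eq))
  lookup-injective (_ ∷ u) (suc i) (suc j) eq = cong suc (lookup-injective u i j eq)

  -- The elements of the setoid carry proofs, so what is listed without repetition is their keys;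
  -- `sound` chooses an element for each key.
  cardinality-list : ∀ {a b} {A : Set a} {B : Set b} (key : B → A) {xs : List A} → Unique xs →
                     (∀ y → key y ∈ˡ xs) → (∀ {x} → x ∈ˡ xs → ∃[ y ] key y ≡ x) →
                     HasCardinality (On.setoid (setoid A) key) (length xs)
  cardinality-list key {xs} u complete sound = record
    { to        = λ i → proj₁ (sound (∈-lookup {xs = xs} i))
    ; from      = λ y → index (complete y)
    ; to-cong   = λ { refl → refl }
    ; from-cong = λ {y} {z} eq → lookup-injective u _ _
        (trans (sym (lookup-index (complete y))) (trans eq (lookup-index (complete z))))
    ; inverse   = (λ { {y} refl → trans (proj₂ (sound (∈-lookup (index (complete y))))) (sym (lookup-index (complete y))) })
                , λ {i} {y} eq → lookup-injective u _ _
                    (trans (sym (lookup-index (complete y))) (trans eq (proj₂ (sound (∈-lookup i)))))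
    }

  -- The fields of `NSGComposition` and the three conditions of `Compositions3`, gathered into one
  -- decidable predicate on the bare list.
  Valid : ℕ → List ℕ → Set
  Valid g xs =
      All (1 ≤_) xs
    × (∀ s t → 1 ≤ s → 1 ≤ t → s + t < m → part xs (s + t) ≤ part xs s + part xs t)
    × (∀ s t → 1 ≤ s → 1 ≤ t → s + t < m →
         part xs (m ∸ s ∸ t) ≤ part xs (m ∸ s) + part xs (m ∸ t) + 1)
    × sum xs ≡ g × foldr _⊔_ 0 xs ≡ 3 × part xs (length xs) ≡ 3
    where m = suc (length xs)

  ∀[s+t<n]? : ∀ {P : ℕ → ℕ → Set} → (∀ s t → Dec (P s t)) → ∀ n →
              Dec (∀ s t → 1 ≤ s → 1 ≤ t → s + t < n → P s t)
  ∀[s+t<n]? {P} P? n = map′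
    {A = ∀ {s} → s < n → ∀ {t} → t < n → 1 ≤ s → 1 ≤ t → s + t < n → P s t}
    (λ f s t 1≤s 1≤t st<n → f (≤-<-trans (m≤m+n s t) st<n) (≤-<-trans (m≤n+m t s) st<n) 1≤s 1≤t st<n)
    (λ f _ _ → f _ _)
    (allUpTo? (λ s → allUpTo? (λ t →
      (1 ≤? s) →-dec (1 ≤? t) →-dec (suc (s + t) ≤? n) →-dec P? s t) n) n)

  valid? : ∀ g xs → Dec (Valid g xs)
  valid? g xs =
    all? (1 ≤?_) xs
    ×-dec ∀[s+t<n]? (λ s t → _ ≤? _) _
    ×-dec ∀[s+t<n]? (λ s t → _ ≤? _) _
    ×-dec (_ ≟ _) ×-dec (_ ≟ _) ×-dec (_ ≟ _)

  words : ℕ → List (List ℕ)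
  words zero    = [] ∷ []
  words (suc n) = cartesianProductWith _∷_ (1 ∷ 2 ∷ 3 ∷ []) (words n)

  ∈-words : ∀ xs → All (1 ≤_) xs → foldr _⊔_ 0 xs ≤ 3 → xs ∈ˡ words (length xs)
  ∈-words []       _            _   = here refl
  ∈-words (x ∷ xs) (1≤x ∷ 1≤xs) ≤3 = ∈-cartesianProductWith⁺ _∷_
      (letter x 1≤x (m⊔n≤o⇒m≤o x _ ≤3)) (∈-words xs 1≤xs (m⊔n≤o⇒n≤o x _ ≤3))
    where
    letter : ∀ x → 1 ≤ x → x ≤ 3 → x ∈ˡ 1 ∷ 2 ∷ 3 ∷ []
    letter 1 _ _ = here refl
    letter 2 _ _ = there (here refl)
    letter 3 _ _ = there (there (here refl))
    letter (suc (suc (suc (suc _)))) _ (s≤s (s≤s (s≤s ())))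

  length≤sum : ∀ xs → All (1 ≤_) xs → length xs ≤ sum xs
  length≤sum []       _            = z≤n
  length≤sum (x ∷ xs) (1≤x ∷ 1≤xs) = +-mono-≤ 1≤x (length≤sum xs 1≤xs)

  -- Positive parts bound the length by the genus, which makes the search finite. Deduplicating
  -- yields uniqueness without an analysis of `words`.
  validWords : ℕ → List (List ℕ)
  validWords g = filter (valid? g) (deduplicate (≡-dec _≟_) (concatMap words (upTo (suc g))))

  validWords-unique : ∀ g → Unique (validWords g)
  validWords-unique g = Unique.filter⁺ (valid? g) (deduplicate-! (concatMap words (upTo (suc g))))

  validWords-sound : ∀ g {xs} → xs ∈ˡ validWords g → Valid g xs
  validWords-sound g {xs} xs∈ =
    proj₂ (∈-filter⁻ (valid? g) {xs = deduplicate (≡-dec _≟_) (concatMap words (upTo (suc g)))} xs∈)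

  validWords-complete : ∀ g {xs} → Valid g xs → xs ∈ˡ validWords g
  validWords-complete g {xs} v@(1≤xs , _ , _ , refl , max≡3 , _) =
    ∈-filter⁺ (valid? g) (∈-deduplicate⁺ (≡-dec _≟_)
      (∈-concatMap⁺ words (Any.map (λ { refl → ∈-words xs 1≤xs (≤-reflexive max≡3) })
        (∈-upTo⁺ (s≤s (length≤sum xs 1≤xs)))))) v

  compositions-cardinality : ∀ g → HasCardinality (Compositions3 g) (length (validWords g))
  compositions-cardinality g = cardinality-list (parts ∘ proj₁) (validWords-unique g)
    (λ (C , eq , max , last) → let open NSGComposition C in
       validWords-complete g (positive , kunz₁ , kunz₂ , eq , max , last))
    (λ {xs} xs∈ → let (pos , k₁ , k₂ , eq , max , last) = validWords-sound g xs∈ in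
       (record { parts = xs ; positive = pos ; kunz₁ = k₁ ; kunz₂ = k₂ } , eq , max , last) , refl)

-- Weighted sums over lists of rationals

module WeightedSums where

  import Data.Nat.Base as ℕ
  import Data.Nat.Properties as ℕ
  open import Data.Nat.Base using (ℕ; zero; suc)
  import Data.Integer.Base as ℤ
  import Data.Integer.Properties as ℤ
  import Data.Nat.Coprimality as Coprime
  open import Data.Rational.Base
  open import Data.Rational.Properties
  open import Data.Rational.Solver using (module +-*-Solver)
  open import Algebra.Definitions.RawSemiring +-*-rawSemiring using (_^_)
  open import Data.Empty using (⊥-elim)
  open import Data.List.Base using (List; []; _∷_; _++_; length; concatMap)
  open import Data.List.Membership.Propositional using () renaming (_∈_ to _∈ˡ_)
  open import Data.List.Membership.Propositional.Properties using (∈-∃++; ∈-++⁺ˡ; ∈-++⁺ʳ; ∈-++⁻)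
  open import Data.List.Relation.Unary.All as All using (All; []; _∷_)
  open import Data.List.Relation.Unary.AllPairs using ([]; _∷_)
  open import Data.List.Relation.Unary.Any as Any using (here; there)
  open import Data.List.Relation.Unary.Unique.Propositional using (Unique)
  open import Data.Product.Base using (_×_; _,_; proj₁; proj₂)
  open import Data.Sum.Base using (inj₁; inj₂)
  open import Function.Base using (_∘_)
  open import Relation.Binary.PropositionalEquality

  0≤1 : 0ℚ ≤ 1ℚ
  0≤1 = ≤ᵇ⇒≤ _

  *-mono-≤ : ∀ {p q r s} → 0ℚ ≤ r → 0ℚ ≤ q → p ≤ q → r ≤ s → p * r ≤ q * s
  *-mono-≤ {q = q} {r = r} 0≤r 0≤q p≤q r≤s = ≤-trans
    (*-monoʳ-≤-nonNeg r {{nonNegative 0≤r}} p≤q) (*-monoˡ-≤-nonNeg q {{nonNegative 0≤q}} r≤s)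

  0≤* : ∀ {p q} → 0ℚ ≤ p → 0ℚ ≤ q → 0ℚ ≤ p * q
  0≤* {p} {q} 0≤p 0≤q = subst (_≤ p * q) (*-zeroˡ q) (*-monoʳ-≤-nonNeg q {{nonNegative 0≤q}} 0≤p)

  0≤+ : ∀ {p q} → 0ℚ ≤ p → 0ℚ ≤ q → 0ℚ ≤ p + q
  0≤+ = +-mono-≤

  0≤^ : ∀ {p} n → 0ℚ ≤ p → 0ℚ ≤ p ^ n
  0≤^ zero    _   = 0≤1
  0≤^ (suc n) 0≤p = 0≤* 0≤p (0≤^ n 0≤p)

  p≤q+p : ∀ {p q} → 0ℚ ≤ q → p ≤ q + p
  p≤q+p {p} {q} 0≤q = subst (_≤ q + p) (+-identityˡ p) (+-monoˡ-≤ p 0≤q)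

  *-swap : ∀ p q r → p * (q * r) ≡ q * (p * r)
  *-swap = solve 3 (λ p q r → p :* (q :* r) := q :* (p :* r)) refl
    where open +-*-Solver

  ^-+ : ∀ p m n → p ^ (m ℕ.+ n) ≡ p ^ m * p ^ n
  ^-+ p zero    n = sym (*-identityˡ _)
  ^-+ p (suc m) n = trans (cong (p *_) (^-+ p m n)) (sym (*-assoc p _ _))

  ^-antimono : ∀ {p m n} → 0ℚ ≤ p → p ≤ 1ℚ → m ℕ.≤ n → p ^ n ≤ p ^ m
  ^-antimono {p} {n = n} 0≤p p≤1 ℕ.z≤n = go n
    where
    go : ∀ n → p ^ n ≤ 1ℚ
    go zero    = ≤-refl
    go (suc n) = *-mono-≤ (0≤^ n 0≤p) 0≤1 p≤1 (go n)
  ^-antimono {p} 0≤p p≤1 (ℕ.s≤s m≤n) = *-monoˡ-≤-nonNeg p {{nonNegative 0≤p}} (^-antimono 0≤p p≤1 m≤n)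

  -- For a variable n the fraction n / 1 is stuck on a gcd; the literal p with an explicit
  -- coprimality proof lets the addition compute.
  fromℕ-suc : ∀ n → fromℕ (suc n) ≡ 1ℚ + fromℕ n
  fromℕ-suc n = sym (trans (cong (1ℚ +_) (↥p/↧p≡p p)) (cong (λ k → (ℤ.1ℤ ℤ.+ k) / 1) (ℤ.*-identityʳ (ℤ.+ n))))
    where
    p : ℚ
    p = mkℚ (ℤ.+ n) 0 (Coprime.sym (Coprime.1-coprimeTo n))

  fromℕ-nonNeg : ∀ n → 0ℚ ≤ fromℕ n
  fromℕ-nonNeg n = nonNegative⁻¹ (fromℕ n) {{normalize-nonNeg n 1}}

  fromℕ-suc-* : ∀ n c → fromℕ (suc n) * c ≡ c + fromℕ n * c
  fromℕ-suc-* n c = trans (cong (_* c) (fromℕ-suc n))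
    (trans (*-distribʳ-+ c 1ℚ (fromℕ n)) (cong (_+ fromℕ n * c) (*-identityˡ c)))

  sumOver : ∀ {a} {A : Set a} → (A → ℚ) → List A → ℚ
  sumOver f []       = 0ℚ
  sumOver f (x ∷ xs) = f x + sumOver f xs

  module _ {a} {A : Set a} where

    sumOver-nonNeg : ∀ {f : A → ℚ} → (∀ x → 0ℚ ≤ f x) → ∀ xs → 0ℚ ≤ sumOver f xs
    sumOver-nonNeg 0≤f []       = ≤-refl
    sumOver-nonNeg 0≤f (x ∷ xs) = 0≤+ (0≤f x) (sumOver-nonNeg 0≤f xs)

    sumOver-mono : ∀ {f g : A → ℚ} → (∀ x → f x ≤ g x) → ∀ xs → sumOver f xs ≤ sumOver g xs
    sumOver-mono f≤g []       = ≤-refl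
    sumOver-mono f≤g (x ∷ xs) = +-mono-≤ (f≤g x) (sumOver-mono f≤g xs)

    sumOver-cong : ∀ {f g : A → ℚ} → (∀ x → f x ≡ g x) → ∀ xs → sumOver f xs ≡ sumOver g xs
    sumOver-cong f≡g []       = refl
    sumOver-cong f≡g (x ∷ xs) = cong₂ _+_ (f≡g x) (sumOver-cong f≡g xs)

    sumOver-*ʳ : ∀ (f : A → ℚ) c xs → sumOver (λ x → f x * c) xs ≡ sumOver f xs * c
    sumOver-*ʳ f c []       = sym (*-zeroˡ c)
    sumOver-*ʳ f c (x ∷ xs) = trans (cong (f x * c +_) (sumOver-*ʳ f c xs)) (sym (*-distribʳ-+ c (f x) (sumOver f xs)))

    sumOver-++ : ∀ (f : A → ℚ) xs ys → sumOver f (xs ++ ys) ≡ sumOver f xs + sumOver f ys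
    sumOver-++ f []       ys = sym (+-identityˡ _)
    sumOver-++ f (x ∷ xs) ys = trans (cong (f x +_) (sumOver-++ f xs ys)) (sym (+-assoc (f x) _ _))

    sumOver-concatMap : ∀ {b} {B : Set b} (f : A → ℚ) (g : B → List A) xs →
                        sumOver f (concatMap g xs) ≡ sumOver (sumOver f ∘ g) xs
    sumOver-concatMap f g []       = refl
    sumOver-concatMap f g (x ∷ xs) = trans (sumOver-++ f (g x) _) (cong (sumOver f (g x) +_) (sumOver-concatMap f g xs))

    sumOver-bounded : ∀ {f : A → ℚ} {c} → (∀ x → f x ≤ c) → ∀ xs → sumOver f xs ≤ fromℕ (length xs) * c
    sumOver-bounded {c = c} f≤c []       = ≤-reflexive (sym (*-zeroˡ c))
    sumOver-bounded {c = c} f≤c (x ∷ xs) = ≤-trans (+-mono-≤ (f≤c x) (sumOver-bounded f≤c xs))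
      (≤-reflexive (sym (fromℕ-suc-* (length xs) c)))

    -- Weighted counting by codes: each element of `xs` consumes one occurrence of its code in `ys`,
    -- and injectivity leaves the codes of the other elements in place.
    unique-code⇒sumOver≥ : ∀ {b} {B : Set b} {f : A → ℚ} (code : B → A) {c} →
      ∀ {xs ys} → Unique xs → (∀ {x} → x ∈ˡ xs → code x ∈ˡ ys × c ≤ f (code x)) →
      (∀ {x y} → x ∈ˡ xs → y ∈ˡ xs → code x ≡ code y → x ≡ y) → (∀ y → 0ℚ ≤ f y) →
      fromℕ (length xs) * c ≤ sumOver f ys
    unique-code⇒sumOver≥ code {c} {[]} {ys} _ _ _ 0≤f =
      ≤-trans (≤-reflexive (*-zeroˡ c)) (sumOver-nonNeg 0≤f ys)
    unique-code⇒sumOver≥ {f = f} code {c} {x ∷ xs} (x∉ ∷ u) into inj 0≤f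
      with ∈-∃++ (proj₁ (into (here refl)))
    ... | as , bs , refl = begin
        fromℕ (suc (length xs)) * c                  ≡⟨ fromℕ-suc-* (length xs) c ⟩
        c + fromℕ (length xs) * c                    ≤⟨ +-mono-≤ (proj₂ (into (here refl)))
                                                          (unique-code⇒sumOver≥ code u rest
                                                            (λ y∈ z∈ → inj (there y∈) (there z∈)) 0≤f) ⟩
        f (code x) + sumOver f (as ++ bs)            ≡⟨ cong (f (code x) +_) (sumOver-++ f as bs) ⟩
        f (code x) + (sumOver f as + sumOver f bs)
          ≡⟨ solve 3 (λ a b c → a :+ (b :+ c) := b :+ (a :+ c)) refl
                                                          (f (code x)) (sumOver f as) (sumOver f bs) ⟩
        sumOver f as + (f (code x) + sumOver f bs)   ≡⟨ sumOver-++ f as (code x ∷ bs) ⟨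
        sumOver f (as ++ code x ∷ bs)                ∎
      where
      open ≤-Reasoning
      open +-*-Solver
      rest : ∀ {y} → y ∈ˡ xs → code y ∈ˡ as ++ bs × c ≤ f (code y)
      rest y∈ with into (there y∈)
      ... | cy∈ , c≤ with ∈-++⁻ as cy∈
      ... | inj₁ cy∈as         = ∈-++⁺ˡ cy∈as , c≤
      ... | inj₂ (here eq)     = ⊥-elim (All.lookup x∉ y∈ (sym (inj (there y∈) (here refl) eq)))
      ... | inj₂ (there cy∈bs) = ∈-++⁺ʳ as cy∈bs , c≤

-- Transfer matrix and potential for interleaved chains of pairs

module Transfer where

  import Data.Nat.Base as ℕ
  import Data.Nat.Properties as ℕ
  open import Data.Nat.Base using (ℕ; zero; suc)
  import Data.Integer.Base as ℤ
  open import Data.Rational.Base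
  open import Data.Rational.Properties
  open import Algebra.Definitions.RawSemiring +-*-rawSemiring using (_^_)
  open import Data.List.Base using (List; []; _∷_; _∷ʳ_; map; concatMap; filter; replicate; cartesianProduct)
  open import Data.List.Properties using (∷-injectiveˡ; ∷-injectiveʳ)
  open import Data.List.Membership.Propositional using () renaming (_∈_ to _∈ˡ_)
  open import Data.List.Membership.Propositional.Properties using (∈-concatMap⁺; ∈-map⁺; ∈-filter⁺; ∈-cartesianProduct⁺)
  open import Data.List.Relation.Unary.Any as Any using (here; there)
  open import Data.Product.Base using (_×_; _,_)
  open import Data.Sum.Base using (_⊎_; inj₁; inj₂)
  open import Function.Base using (_∘_)
  open import Relation.Binary.PropositionalEquality
  open import Relation.Nullary using (Dec)
  open import Relation.Nullary.Decidable using (_×-dec_)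
  open WeightedSums

  data Letter : Set where
    one two three : Letter

  value : Letter → ℕ
  value one   = 1
  value two   = 2
  value three = 3

  letter : ℕ → Letter
  letter 1 = one
  letter 2 = two
  letter _ = three

  value-letter : ∀ {x} → 1 ℕ.≤ x → x ℕ.≤ 3 → value (letter x) ≡ x
  value-letter {1} _ _ = refl
  value-letter {2} _ _ = refl
  value-letter {3} _ _ = refl
  value-letter {suc (suc (suc (suc _)))} _ (ℕ.s≤s (ℕ.s≤s (ℕ.s≤s ())))

  Pair : Set
  Pair = Letter × Letter

  -- What a pair has to follow: the pair i + 1 places before it or, for lack of
  -- one, the requirement that its left letter is not 1 (start), or is the first 1 (first).
  data State : Set where
    start first : State
    pair        : Pair → State

  -- As letters lie between 1 and 3, c ≤ a + 1 only forbids c = 3 after a = 1, and b ≤ d + 1 only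
  -- forbids d = 1 after b = 3. Hence a good potential need only distinguish whether a = 1 and
  -- whether b = 3. The condition 3 ≤ c + d excludes (1,1).
  Entry : State → ℕ → ℕ → Set
  Entry start            c d = 2 ℕ.≤ c × 3 ℕ.≤ c ℕ.+ d
  Entry first            c d = c ℕ.≤ 1 × 3 ℕ.≤ c ℕ.+ d
  Entry (pair (a , b)) c d = (c ℕ.≤ value a ℕ.+ 1 × value b ℕ.≤ d ℕ.+ 1) × 3 ℕ.≤ c ℕ.+ d

  entry? : ∀ s c d → Dec (Entry s c d)
  entry? start            c d = (2 ℕ.≤? c) ×-dec (3 ℕ.≤? c ℕ.+ d)
  entry? first            c d = (c ℕ.≤? 1) ×-dec (3 ℕ.≤? c ℕ.+ d)
  entry? (pair (a , b)) c d =
    ((c ℕ.≤? value a ℕ.+ 1) ×-dec (value b ℕ.≤? d ℕ.+ 1)) ×-dec (3 ℕ.≤? c ℕ.+ d)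

  letters : List Letter
  letters = one ∷ two ∷ three ∷ []

  ∈-letters : ∀ a → a ∈ˡ letters
  ∈-letters one   = here refl
  ∈-letters two   = there (here refl)
  ∈-letters three = there (there (here refl))

  next : State → List Pair
  next s = filter (λ (c , d) → entry? s (value c) (value d)) (cartesianProduct letters letters)

  ∈-next : ∀ s {c d} → Entry s (value c) (value d) → (c , d) ∈ˡ next s
  ∈-next s {c} {d} = ∈-filter⁺ (λ (c , d) → entry? s (value c) (value d))
    (∈-cartesianProduct⁺ (∈-letters c) (∈-letters d))

  𝕢 : ℚ
  𝕢 = ℤ.+ 5 / 8

  0≤𝕢 : 0ℚ ≤ 𝕢
  0≤𝕢 = ≤ᵇ⇒≤ _

  total : List Pair → ℕ
  total []             = 0
  total ((a , b) ∷ ps) = value a ℕ.+ value b ℕ.+ total ps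

  weight : List Pair → ℚ
  weight ps = 𝕢 ^ total ps

  pairWeight : Pair → ℚ
  pairWeight (a , b) = 𝕢 ^ (value a ℕ.+ value b)

  -- A rounded supersolution for the transfer matrix of next with letter weights 𝕢,
  -- close to its Perron eigenvector.
  potential : State → ℚ
  potential start                = 1ℚ
  potential first                = 1ℚ
  potential (pair (one , three)) = ℤ.+ 13 / 20
  potential (pair (one , _))     = ℤ.+ 19 / 20
  potential (pair (_ , three))   = ℤ.+ 16 / 20
  potential (pair (_ , _))       = ℤ.+ 27 / 20

  0≤potential : ∀ s → 0ℚ ≤ potential s
  0≤potential start                  = ≤ᵇ⇒≤ _
  0≤potential first                  = ≤ᵇ⇒≤ _
  0≤potential (pair (one , one))     = ≤ᵇ⇒≤ _
  0≤potential (pair (one , two))     = ≤ᵇ⇒≤ _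
  0≤potential (pair (one , three))   = ≤ᵇ⇒≤ _
  0≤potential (pair (two , one))     = ≤ᵇ⇒≤ _
  0≤potential (pair (two , two))     = ≤ᵇ⇒≤ _
  0≤potential (pair (two , three))   = ≤ᵇ⇒≤ _
  0≤potential (pair (three , one))   = ≤ᵇ⇒≤ _
  0≤potential (pair (three , two))   = ≤ᵇ⇒≤ _
  0≤potential (pair (three , three)) = ≤ᵇ⇒≤ _

  -- A chain may end at any pair, which then counts as 1. As some potentials lie below 1, this does
  -- not follow from `potential-step`; it is what forces 13/20 and 16/20 among the multiples of
  -- 1/20, the sums being about 0.645 and 0.7996.
  potential-stop : ∀ s → sumOver pairWeight (next s) ≤ potential s
  potential-stop start                  = ≤ᵇ⇒≤ _
  potential-stop first                  = ≤ᵇ⇒≤ _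
  potential-stop (pair (one , one))     = ≤ᵇ⇒≤ _
  potential-stop (pair (one , two))     = ≤ᵇ⇒≤ _
  potential-stop (pair (one , three))   = ≤ᵇ⇒≤ _
  potential-stop (pair (two , one))     = ≤ᵇ⇒≤ _
  potential-stop (pair (two , two))     = ≤ᵇ⇒≤ _
  potential-stop (pair (two , three))   = ≤ᵇ⇒≤ _
  potential-stop (pair (three , one))   = ≤ᵇ⇒≤ _
  potential-stop (pair (three , two))   = ≤ᵇ⇒≤ _
  potential-stop (pair (three , three)) = ≤ᵇ⇒≤ _

  potential-step : ∀ s → sumOver (λ p → pairWeight p * potential (pair p)) (next s) ≤ potential s
  potential-step start                  = ≤ᵇ⇒≤ _
  potential-step first                  = ≤ᵇ⇒≤ _
  potential-step (pair (one , one))     = ≤ᵇ⇒≤ _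
  potential-step (pair (one , two))     = ≤ᵇ⇒≤ _
  potential-step (pair (one , three))   = ≤ᵇ⇒≤ _
  potential-step (pair (two , one))     = ≤ᵇ⇒≤ _
  potential-step (pair (two , two))     = ≤ᵇ⇒≤ _
  potential-step (pair (two , three))   = ≤ᵇ⇒≤ _
  potential-step (pair (three , one))   = ≤ᵇ⇒≤ _
  potential-step (pair (three , two))   = ≤ᵇ⇒≤ _
  potential-step (pair (three , three)) = ≤ᵇ⇒≤ _

  -- The queue holds the last i + 1 states: its head constrains the next pair.
  continuations : ℕ → List State → List (List Pair)
  continuations zero    _       = [] ∷ []
  continuations (suc r) []      = []
  continuations (suc r) (s ∷ Q) = concatMap (λ p → map (p ∷_) (continuations r (Q ∷ʳ pair p))) (next s)

  -- With r pairs to go, the entries after the first r are ends of their chains and count as 1.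
  queuePotential : ℕ → List State → ℚ
  queuePotential _       []      = 1ℚ
  queuePotential zero    (_ ∷ _) = 1ℚ
  queuePotential (suc r) (s ∷ Q) = potential s * queuePotential r Q

  0≤queuePotential : ∀ r Q → 0ℚ ≤ queuePotential r Q
  0≤queuePotential r       []      = 0≤1
  0≤queuePotential zero    (_ ∷ _) = 0≤1
  0≤queuePotential (suc r) (s ∷ Q) = 0≤* (0≤potential s) (0≤queuePotential r Q)

  -- A state at the end of the queue still gets a successor iff fewer than r states precede it. The
  -- alternative is the same for all s, so a sum over the next pair can be treated uniformly.
  queuePotential-∷ʳ : ∀ r Q → (∀ s → queuePotential r (Q ∷ʳ s) ≡ 1ℚ * queuePotential r Q)
                            ⊎ (∀ s → queuePotential r (Q ∷ʳ s) ≡ potential s * queuePotential r Q)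
  queuePotential-∷ʳ zero    []      = inj₁ λ _ → refl
  queuePotential-∷ʳ zero    (_ ∷ _) = inj₁ λ _ → refl
  queuePotential-∷ʳ (suc r) []      = inj₂ λ _ → refl
  queuePotential-∷ʳ (suc r) (u ∷ Q) with queuePotential-∷ʳ r Q
  ... | inj₁ eq = inj₁ λ s → trans (cong (potential u *_) (eq s)) (*-swap (potential u) 1ℚ _)
  ... | inj₂ eq = inj₂ λ s → trans (cong (potential u *_) (eq s)) (*-swap (potential u) (potential s) _)

  sumOver-weight-∷ : ∀ p pss → sumOver weight (map (p ∷_) pss) ≡ sumOver weight pss * pairWeight p
  sumOver-weight-∷ p []         = sym (*-zeroˡ (pairWeight p))
  sumOver-weight-∷ p@(a , b) (ps ∷ pss) = trans
    (cong₂ _+_ (trans (^-+ 𝕢 (value a ℕ.+ value b) (total ps)) (*-comm (pairWeight p) (weight ps))) (sumOver-weight-∷ p pss))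
    (sym (*-distribʳ-+ (pairWeight p) (weight ps) _))

  0≤weight : ∀ ps → 0ℚ ≤ weight ps
  0≤weight ps = 0≤^ (total ps) 0≤𝕢

  -- The chains do not interact, so the bound is a product over the queue. Choosing a pair replaces
  -- the head of its chain: `potential-step` pays for it if the chain goes on, `potential-stop` if
  -- it ends there.
  continuations-weight : ∀ r Q → sumOver weight (continuations r Q) ≤ queuePotential r Q
  continuations-weight zero    []      = ≤-refl
  continuations-weight zero    (_ ∷ _) = ≤-refl
  continuations-weight (suc r) []      = 0≤1
  continuations-weight (suc r) (s ∷ Q) = begin
    sumOver weight (continuations (suc r) (s ∷ Q))
      ≡⟨ sumOver-concatMap weight _ (next s) ⟩
    sumOver (λ p → sumOver weight (map (p ∷_) (continuations r (Q ∷ʳ pair p)))) (next s)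
      ≤⟨ sumOver-mono (λ p → ≤-trans (≤-reflexive (sumOver-weight-∷ p (continuations r (Q ∷ʳ pair p))))
           (≤-trans (*-monoʳ-≤-nonNeg (pairWeight p) {{nonNegative (0≤pairWeight p)}} (continuations-weight r (Q ∷ʳ pair p)))
             (≤-reflexive (*-comm _ (pairWeight p))))) (next s) ⟩
    sumOver (λ p → pairWeight p * queuePotential r (Q ∷ʳ pair p)) (next s)
      ≤⟨ push (queuePotential-∷ʳ r Q) ⟩
    potential s * queuePotential r Q ∎
    where
    open ≤-Reasoning
    0≤pairWeight : ∀ p → 0ℚ ≤ pairWeight p
    0≤pairWeight (a , b) = 0≤^ (value a ℕ.+ value b) 0≤𝕢
    factor : ∀ (f : Pair → ℚ) → (∀ p → queuePotential r (Q ∷ʳ pair p) ≡ f p * queuePotential r Q) →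
             sumOver (λ p → pairWeight p * f p) (next s) ≤ potential s →
             sumOver (λ p → pairWeight p * queuePotential r (Q ∷ʳ pair p)) (next s) ≤ potential s * queuePotential r Q
    factor f eq le = begin
      sumOver (λ p → pairWeight p * queuePotential r (Q ∷ʳ pair p)) (next s)
        ≡⟨ sumOver-cong (λ p → trans (cong (pairWeight p *_) (eq p)) (sym (*-assoc (pairWeight p) (f p) _))) (next s) ⟩
      sumOver (λ p → pairWeight p * f p * queuePotential r Q) (next s)
        ≡⟨ sumOver-*ʳ (λ p → pairWeight p * f p) (queuePotential r Q) (next s) ⟩
      sumOver (λ p → pairWeight p * f p) (next s) * queuePotential r Q
        ≤⟨ *-monoʳ-≤-nonNeg (queuePotential r Q) {{nonNegative (0≤queuePotential r Q)}} le ⟩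
      potential s * queuePotential r Q ∎
    push : (∀ s → queuePotential r (Q ∷ʳ s) ≡ 1ℚ * queuePotential r Q)
         ⊎ (∀ s → queuePotential r (Q ∷ʳ s) ≡ potential s * queuePotential r Q) →
         sumOver (λ p → pairWeight p * queuePotential r (Q ∷ʳ pair p)) (next s) ≤ potential s * queuePotential r Q
    push (inj₁ eq) = factor (λ _ → 1ℚ) (eq ∘ pair)
      (≤-trans (≤-reflexive (sumOver-cong (λ p → *-identityʳ (pairWeight p)) (next s))) (potential-stop s))
    push (inj₂ eq) = factor (potential ∘ pair) (eq ∘ pair) (potential-step s)

  initialQueue : ℕ → List State
  initialQueue i = replicate i start ∷ʳ first

  -- Every chain starts at potential 1, so the bound is uniform in the number i + 1 of chains.
  initialQueue-potential : ∀ r i → queuePotential r (initialQueue i) ≡ 1ℚ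
  initialQueue-potential zero    zero    = refl
  initialQueue-potential (suc r) zero    = refl
  initialQueue-potential zero    (suc i) = refl
  initialQueue-potential (suc r) (suc i) = trans (*-identityˡ _) (initialQueue-potential r i)

  -- The sequence of i times `start`, then `first`, then the pairs p 0, p 1, and so on: the whole
  -- history of the queue laid out on one line, the queue before step t being its window of length i
  -- + 1 at t.
  stateAt : ℕ → (ℕ → Pair) → ℕ → State
  stateAt zero    p zero    = first
  stateAt zero    p (suc t) = pair (p t)
  stateAt (suc i) p zero    = start
  stateAt (suc i) p (suc t) = stateAt i p t

  stateAt-pair : ∀ i p t → stateAt i p (t ℕ.+ suc i) ≡ pair (p t)
  stateAt-pair zero    p t rewrite ℕ.+-comm t 1             = refl
  stateAt-pair (suc i) p t rewrite ℕ.+-suc t (suc i) = stateAt-pair i p t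

  stateAt-elim : ∀ (P : ℕ → State → Set) i p → (∀ k → k ℕ.< i → P k start) → P i first →
                 (∀ t → P (t ℕ.+ suc i) (pair (p t))) → ∀ k → P k (stateAt i p k)
  stateAt-elim P zero    p _ f _ zero    = f
  stateAt-elim P zero    p _ _ g (suc t) = subst (λ k → P k (pair (p t))) (ℕ.+-comm t 1) (g t)
  stateAt-elim P (suc i) p s _ _ zero    = s 0 (ℕ.s≤s ℕ.z≤n)
  stateAt-elim P (suc i) p s f g (suc k) = stateAt-elim (P ∘ suc) i p (λ k k<i → s (suc k) (ℕ.s≤s k<i)) f
    (λ t → subst (λ k → P k (pair (p t))) (ℕ.+-suc t (suc i)) (g t)) k

  applyFrom : ∀ {a} {A : Set a} → (ℕ → A) → ℕ → ℕ → List A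
  applyFrom f t zero    = []
  applyFrom f t (suc n) = f t ∷ applyFrom f (suc t) n

  applyFrom-∷ʳ : ∀ {a} {A : Set a} (f : ℕ → A) t n → applyFrom f t n ∷ʳ f (t ℕ.+ n) ≡ applyFrom f t (suc n)
  applyFrom-∷ʳ f t zero    = cong (λ k → f k ∷ []) (ℕ.+-identityʳ t)
  applyFrom-∷ʳ f t (suc n) = cong (f t ∷_)
    (trans (cong (λ k → applyFrom f (suc t) n ∷ʳ f k) (ℕ.+-suc t n)) (applyFrom-∷ʳ f (suc t) n))

  applyFrom-suc : ∀ {a} {A : Set a} (f : ℕ → A) t n → applyFrom f (suc t) n ≡ applyFrom (f ∘ suc) t n
  applyFrom-suc f t zero    = refl
  applyFrom-suc f t (suc n) = cong (f (suc t) ∷_) (applyFrom-suc f (suc t) n)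

  applyFrom-injective : ∀ {a} {A : Set a} {f g : ℕ → A} t n → applyFrom f t n ≡ applyFrom g t n →
                        ∀ k → k ℕ.< n → f (t ℕ.+ k) ≡ g (t ℕ.+ k)
  applyFrom-injective t (suc n) eq zero _ rewrite ℕ.+-identityʳ t = ∷-injectiveˡ eq
  applyFrom-injective t (suc n) eq (suc k) (ℕ.s≤s k<n) rewrite ℕ.+-suc t k =
    applyFrom-injective (suc t) n (∷-injectiveʳ eq) k k<n

  initialQueue-stateAt : ∀ i p → applyFrom (stateAt i p) 0 (suc i) ≡ initialQueue i
  initialQueue-stateAt zero    p = refl
  initialQueue-stateAt (suc i) p = cong (start ∷_)
    (trans (applyFrom-suc (stateAt (suc i) p) 0 (suc i)) (initialQueue-stateAt i p))

  -- Sliding the window by one drops the state at t and appends the one at t + i + 1, which is the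
  -- pair just chosen. So the queue of `continuations` remains a window of `stateAt`.
  ∈-continuations : ∀ i p r t → (∀ k → k ℕ.< t ℕ.+ r → p k ∈ˡ next (stateAt i p k)) →
                    applyFrom p t r ∈ˡ continuations r (applyFrom (stateAt i p) t (suc i))
  ∈-continuations i p zero    t _  = here refl
  ∈-continuations i p (suc r) t p∈ = ∈-concatMap⁺ _ (Any.map (λ { refl → ∈-map⁺ (p t ∷_) tail }) (p∈ t (ℕ.m<m+n t (ℕ.s≤s ℕ.z≤n))))
    where
    open ≡-Reasoning
    queue : applyFrom (stateAt i p) (suc t) (suc i) ≡ applyFrom (stateAt i p) (suc t) i ∷ʳ pair (p t)
    queue = begin
      applyFrom (stateAt i p) (suc t) (suc i)
        ≡⟨ applyFrom-∷ʳ (stateAt i p) (suc t) i ⟨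
      applyFrom (stateAt i p) (suc t) i ∷ʳ stateAt i p (suc (t ℕ.+ i))
        ≡⟨ cong (λ k → applyFrom (stateAt i p) (suc t) i ∷ʳ stateAt i p k) (ℕ.+-suc t i) ⟨
      applyFrom (stateAt i p) (suc t) i ∷ʳ stateAt i p (t ℕ.+ suc i)
        ≡⟨ cong (applyFrom (stateAt i p) (suc t) i ∷ʳ_) (stateAt-pair i p t) ⟩
      applyFrom (stateAt i p) (suc t) i ∷ʳ pair (p t)                      ∎
    tail : applyFrom p (suc t) r ∈ˡ continuations r (applyFrom (stateAt i p) (suc t) i ∷ʳ pair (p t))
    tail = subst (λ Q → applyFrom p (suc t) r ∈ˡ continuations r Q) queue
      (∈-continuations i p r (suc t) (λ k k< → p∈ k (subst (k ℕ.<_) (sym (ℕ.+-suc t r)) k<)))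

-- Encoding words by their pairs

module Codes where

  open import Data.Nat
  open import Data.Nat.Properties hiding (*-mono-≤)
  open import Data.Nat.ListAction using (sum)
  open import Data.Nat.ListAction.Properties using (sum-++)
  open import Data.Nat.Solver using (module +-*-Solver)
  open import Data.Rational.Base as ℚ using (ℚ; 1ℚ)
  import Data.Rational.Properties as ℚ
  open import Algebra.Definitions.RawSemiring ℚ.+-*-rawSemiring using () renaming (_^_ to _^ℚ_)
  open import Data.Empty using (⊥-elim)
  open import Data.List.Base using (List; []; _∷_; _∷ʳ_; length; map; concatMap; applyUpTo; upTo)
  open import Data.List.Properties using (applyUpTo-∷ʳ; length-upTo)
  open import Data.List.Membership.Propositional using () renaming (_∈_ to _∈ˡ_)
  open import Data.List.Membership.Propositional.Properties using (∈-concatMap⁺; ∈-map⁺; ∈-upTo⁺)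
  open import Data.List.Relation.Unary.All using (All)
  import Data.List.Relation.Unary.Any as Any
  open import Data.Product.Base using (∃-syntax; _×_; _,_; proj₁; proj₂)
  open import Data.Sum.Base using (inj₁; inj₂)
  open import Function.Base using (_∘_)
  open import Relation.Binary.PropositionalEquality
  open import Relation.Nullary using (¬_; Dec; yes; no)
  open KunzCoordinates
  open Enumeration
  open WeightedSums
  open Transfer

  Σ< : (ℕ → ℕ) → ℕ → ℕ
  Σ< f zero    = 0
  Σ< f (suc n) = Σ< f n + f n

  Σ<-mono : ∀ f {m n} → m ≤ n → Σ< f m ≤ Σ< f n
  Σ<-mono f m≤n = go (≤⇒≤′ m≤n)
    where
    go : ∀ {m n} → m ≤′ n → Σ< f m ≤ Σ< f n
    go ≤′-refl       = ≤-refl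
    go (≤′-step m≤n) = ≤-trans (go m≤n) (m≤m+n _ _)

  -- Shifts a window of summation by one place. In `total≤g` this trades x_ℓ = 3 for a part that is
  -- at most 3.
  Σ<-suc : ∀ f n → Σ< (f ∘ suc) n + f 0 ≡ Σ< f n + f n
  Σ<-suc f zero    = refl
  Σ<-suc f (suc n) = begin
    Σ< (f ∘ suc) n + f (suc n) + f 0    ≡⟨ +-assoc (Σ< (f ∘ suc) n) _ _ ⟩
    Σ< (f ∘ suc) n + (f (suc n) + f 0)  ≡⟨ cong (Σ< (f ∘ suc) n +_) (+-comm (f (suc n)) (f 0)) ⟩
    Σ< (f ∘ suc) n + (f 0 + f (suc n))  ≡⟨ +-assoc (Σ< (f ∘ suc) n) _ _ ⟨
    Σ< (f ∘ suc) n + f 0 + f (suc n)    ≡⟨ cong (_+ f (suc n)) (Σ<-suc f n) ⟩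
    Σ< f n + f n + f (suc n)            ∎
    where open ≡-Reasoning

  Σ<-reverse : ∀ f {n h} → h ≤ n → Σ< (f ∘ suc) n ≡ Σ< (f ∘ suc) (n ∸ h) + Σ< (λ k → f (n ∸ k)) h
  Σ<-reverse f {n} {zero}  _   = sym (+-identityʳ _)
  Σ<-reverse f {n} {suc h} h<n = begin
    Σ< (f ∘ suc) n                                                          ≡⟨ Σ<-reverse f (<⇒≤ h<n) ⟩
    Σ< (f ∘ suc) (n ∸ h) + Σ< (λ k → f (n ∸ k)) h
      ≡⟨ cong (λ k → Σ< (f ∘ suc) k + Σ< (λ k → f (n ∸ k)) h) eq ⟩
    Σ< (f ∘ suc) (n ∸ suc h) + f (suc (n ∸ suc h)) + Σ< (λ k → f (n ∸ k)) h
      ≡⟨ cong (λ k → Σ< (f ∘ suc) (n ∸ suc h) + f k + Σ< (λ k → f (n ∸ k)) h) eq ⟨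
    Σ< (f ∘ suc) (n ∸ suc h) + f (n ∸ h) + Σ< (λ k → f (n ∸ k)) h
      ≡⟨ +-assoc (Σ< (f ∘ suc) (n ∸ suc h)) _ _ ⟩
    Σ< (f ∘ suc) (n ∸ suc h) + (f (n ∸ h) + Σ< (λ k → f (n ∸ k)) h)
      ≡⟨ cong (Σ< (f ∘ suc) (n ∸ suc h) +_) (+-comm (f (n ∸ h)) _) ⟩
    Σ< (f ∘ suc) (n ∸ suc h) + (Σ< (λ k → f (n ∸ k)) h + f (n ∸ h))         ∎
    where
    open ≡-Reasoning
    eq : n ∸ h ≡ suc (n ∸ suc h)
    eq = +-∸-assoc 1 h<n

  sum-part : ∀ xs → sum xs ≡ Σ< (part xs ∘ suc) (length xs)
  sum-part xs = trans (cong sum (sym (applyUpTo-part xs))) (go (part xs ∘ suc) (length xs))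
    where
    go : ∀ f n → sum (applyUpTo f n) ≡ Σ< f n
    go f zero    = refl
    go f (suc n) = begin
      sum (applyUpTo f (suc n))        ≡⟨ cong sum (applyUpTo-∷ʳ f n) ⟨
      sum (applyUpTo f n ∷ʳ f n)       ≡⟨ sum-++ (applyUpTo f n) _ ⟩
      sum (applyUpTo f n) + (f n + 0)  ≡⟨ cong₂ _+_ (go f n) (+-identityʳ (f n)) ⟩
      Σ< f n + f n                     ∎
      where open ≡-Reasoning

  total-∷ʳ : ∀ ps a b → total (ps ∷ʳ (a , b)) ≡ total ps + (value a + value b)
  total-∷ʳ []             a b = +-identityʳ (value a + value b)
  total-∷ʳ ((c , d) ∷ ps) a b =
    trans (cong (value c + value d +_) (total-∷ʳ ps a b)) (sym (+-assoc (value c + value d) (total ps) _))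

  ⌊n/2⌋+⌊n/2⌋≤n : ∀ n → ⌊ n /2⌋ + ⌊ n /2⌋ ≤ n
  ⌊n/2⌋+⌊n/2⌋≤n n = ≤-trans (+-monoʳ-≤ ⌊ n /2⌋ (⌊n/2⌋≤⌈n/2⌉ n)) (≤-reflexive (⌊n/2⌋+⌈n/2⌉≡n n))

  n≤1+⌊n/2⌋+⌊n/2⌋ : ∀ n → n ≤ suc (⌊ n /2⌋ + ⌊ n /2⌋)
  n≤1+⌊n/2⌋+⌊n/2⌋ zero          = z≤n
  n≤1+⌊n/2⌋+⌊n/2⌋ (suc zero)    = s≤s z≤n
  n≤1+⌊n/2⌋+⌊n/2⌋ (suc (suc n)) =
    s≤s (subst (suc n ≤_) (cong suc (sym (+-suc ⌊ n /2⌋ ⌊ n /2⌋))) (s≤s (n≤1+⌊n/2⌋+⌊n/2⌋ n)))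

  -- A failed search returns n. With i = h all pairs of a word get the state `start`, which covers
  -- the words without a left 1.
  least : ∀ {P : ℕ → Set} → (∀ k → Dec (P k)) → ∀ n →
          ∃[ i ] i ≤ n × (∀ k → k < i → ¬ P k) × (i < n → P i)
  least P? zero = 0 , z≤n , (λ _ ()) , λ ()
  least {P} P? (suc n) with least P? n
  ... | i , i≤n , below , at with m≤n⇒m<n∨m≡n i≤n
  ... | inj₁ i<n = i , m≤n⇒m≤1+n i≤n , below , λ _ → at i<n
  ... | inj₂ refl with P? n
  ...   | yes Pn = n , n≤1+n n , below , λ _ → Pn
  ...   | no ¬Pn = suc n , ≤-refl , below′ , λ n<n → ⊥-elim (<-irrefl refl n<n)
    where
    below′ : ∀ k → k < suc n → ¬ P k
    below′ k k<1+n with m≤n⇒m<n∨m≡n (s≤s⁻¹ k<1+n)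
    ... | inj₁ k<n  = below k k<n
    ... | inj₂ refl = ¬Pn

  pairsOf : List ℕ → ℕ → Pair
  pairsOf xs t = letter (part xs (suc t)) , letter (part xs (length xs ∸ suc t))

  pairList : List ℕ → List Pair
  pairList xs = applyFrom (pairsOf xs) 0 ⌊ length xs /2⌋

  module ValidWord {g xs} (valid : Valid g xs) where

    private
      ℓ h : ℕ
      ℓ = length xs
      h = ⌊ ℓ /2⌋
      x : ℕ → ℕ
      x = part xs

    positive : All (1 ≤_) xs
    positive = proj₁ valid

    kunz₁ : ∀ s t → 1 ≤ s → 1 ≤ t → s + t ≤ ℓ → x (s + t) ≤ x s + x t
    kunz₁ s t 1≤s 1≤t st≤ℓ = proj₁ (proj₂ valid) s t 1≤s 1≤t (s≤s st≤ℓ)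

    sum≡g : sum xs ≡ g
    sum≡g = proj₁ (proj₂ (proj₂ (proj₂ valid)))

    last≡3 : x ℓ ≡ 3
    last≡3 = proj₂ (proj₂ (proj₂ (proj₂ (proj₂ valid))))

    x≤3 : ∀ r → x r ≤ 3
    x≤3 r = ≤-trans (part≤maximum xs r) (≤-reflexive (proj₁ (proj₂ (proj₂ (proj₂ (proj₂ valid))))))

    value-x : ∀ {r} → 1 ≤ r → r ≤ ℓ → value (letter (x r)) ≡ x r
    value-x {r} 1≤r r≤ℓ = value-letter (All⇒part positive 1≤r r≤ℓ) (x≤3 r)

    module _ {t} (t<h : t < h) where

      left≤ : suc t ≤ ℓ
      left≤ = ≤-trans t<h (≤-trans (m≤m+n h h) (⌊n/2⌋+⌊n/2⌋≤n ℓ))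

      right≥ : 1 ≤ ℓ ∸ suc t
      right≥ = ≤-trans (≤-trans (s≤s z≤n) t<h)
        (m+n≤o⇒m≤o∸n h (≤-trans (+-monoʳ-≤ h t<h) (⌊n/2⌋+⌊n/2⌋≤n ℓ)))

      value-left : value (letter (x (suc t))) ≡ x (suc t)
      value-left = value-x (s≤s z≤n) left≤

      value-right : value (letter (x (ℓ ∸ suc t))) ≡ x (ℓ ∸ suc t)
      value-right = value-x right≥ (m∸n≤m ℓ (suc t))

      3≤pair : 3 ≤ x (suc t) + x (ℓ ∸ suc t)
      3≤pair = subst (_≤ x (suc t) + x (ℓ ∸ suc t)) (trans (cong x eq) last≡3)
        (kunz₁ (suc t) (ℓ ∸ suc t) (s≤s z≤n) right≥ (≤-reflexive eq))
        where
        eq : suc t + (ℓ ∸ suc t) ≡ ℓ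
        eq = m+[n∸m]≡n left≤

    private
      Fits : ℕ → State → Set
      Fits k s = k < h → Entry s (x (suc k)) (x (ℓ ∸ suc k))

    -- Before i the left letters exceed 1, at i the letter is 1, and beyond i the part x_{i+1} = 1
    -- enters the first Kunz condition. A position beyond i but below h forces i < h, so the search
    -- has then really found a 1.
    fits : ∃[ i ] i ≤ h × (∀ k → Fits k (stateAt i (pairsOf xs) k))
    fits with least (λ k → x (suc k) ≤? 1) h
    ... | i , i≤h , below , at = i , i≤h , stateAt-elim Fits i (pairsOf xs)
          (λ k k<i k<h → ≰⇒> (below k k<i) , 3≤pair k<h)
          (λ i<h → at i<h , 3≤pair i<h)
          after
      where
      after : ∀ t → Fits (t + suc i) (pair (pairsOf xs t))
      after t k<h = (subst (λ v → x (suc k) ≤ v + 1) (sym (value-left t<h)) left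
                   , subst (_≤ x (ℓ ∸ suc k) + 1) (sym (value-right t<h)) right) , 3≤pair k<h
        where
        k = t + suc i
        t<h : t < h
        t<h = ≤-trans (s≤s (m≤m+n t (suc i))) k<h
        i<h : i < h
        i<h = ≤-trans (s≤s (≤-trans (n≤1+n i) (m≤n+m (suc i) t))) k<h
        left : x (suc k) ≤ x (suc t) + 1
        left = ≤-trans (kunz₁ (suc t) (suc i) (s≤s z≤n) (s≤s z≤n) (left≤ k<h)) (+-monoʳ-≤ (x (suc t)) (at i<h))
        eq : ℓ ∸ suc k + suc i ≡ ℓ ∸ suc t
        eq = trans (cong (_+ suc i) (sym (∸-+-assoc ℓ (suc t) (suc i))))
          (m∸n+n≡m (m+n≤o⇒m≤o∸n (suc i) (subst (_≤ ℓ) (+-comm (suc t) (suc i)) (left≤ k<h))))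
        -- On the right the later pair has the smaller index, so the same part x_{i+1} bounds the
        -- earlier letter in terms of the later one.
        right : x (ℓ ∸ suc t) ≤ x (ℓ ∸ suc k) + 1
        right = ≤-trans (subst (λ r → x r ≤ x (ℓ ∸ suc k) + x (suc i)) eq
            (kunz₁ (ℓ ∸ suc k) (suc i) (right≥ k<h) (s≤s z≤n) (≤-trans (≤-reflexive eq) (m∸n≤m ℓ (suc t)))))
          (+-monoʳ-≤ (x (ℓ ∸ suc k)) (at i<h))

    pairList-∈ : ∃[ i ] i ≤ h × pairList xs ∈ˡ continuations h (initialQueue i)
    pairList-∈ with fits
    ... | i , i≤h , fit = i , i≤h , subst (λ Q → pairList xs ∈ˡ continuations h Q)
        (initialQueue-stateAt i (pairsOf xs))
        (∈-continuations i (pairsOf xs) h 0 λ k k<h → ∈-next (stateAt i (pairsOf xs) k)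
          (subst₂ (Entry (stateAt i (pairsOf xs) k)) (sym (value-left k<h)) (sym (value-right k<h)) (fit k k<h)))

    total-pairs : ∀ n → n ≤ h → total (applyFrom (pairsOf xs) 0 n) ≡ Σ< (x ∘ suc) n + Σ< (λ k → x (ℓ ∸ suc k)) n
    total-pairs zero    _   = refl
    total-pairs (suc n) n<h = begin
      total (applyFrom (pairsOf xs) 0 (suc n))
        ≡⟨ cong total (applyFrom-∷ʳ (pairsOf xs) 0 n) ⟨
      total (applyFrom (pairsOf xs) 0 n ∷ʳ pairsOf xs n)
        ≡⟨ total-∷ʳ (applyFrom (pairsOf xs) 0 n) _ _ ⟩
      total (applyFrom (pairsOf xs) 0 n) + (value (letter (x (suc n))) + value (letter (x (ℓ ∸ suc n))))
        ≡⟨ cong₂ _+_ (total-pairs n (<⇒≤ n<h)) (cong₂ _+_ (value-left n<h) (value-right n<h)) ⟩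
      Σ< (x ∘ suc) n + Σ< (λ k → x (ℓ ∸ suc k)) n + (x (suc n) + x (ℓ ∸ suc n))
        ≡⟨ solve 4 (λ a b c d → a :+ b :+ (c :+ d)
             := a :+ c :+ (b :+ d)) refl (Σ< (x ∘ suc) n) (Σ< (λ k → x (ℓ ∸ suc k)) n) (x (suc n)) (x (ℓ ∸ suc n)) ⟩
      Σ< (x ∘ suc) (suc n) + Σ< (λ k → x (ℓ ∸ suc k)) (suc n)         ∎
      where
      open ≡-Reasoning
      open +-*-Solver

    -- For even ℓ the middle letter is counted twice, but the last letter 3 not at all.
    total≤g : total (pairList xs) ≤ g
    total≤g = begin
      total (pairList xs)                                  ≡⟨ total-pairs h ≤-refl ⟩
      Σ< (x ∘ suc) h + Σ< (λ k → x (ℓ ∸ suc k)) h          ≤⟨ +-monoʳ-≤ (Σ< (x ∘ suc) h) shift ⟩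
      Σ< (x ∘ suc) h + Σ< (λ k → x (ℓ ∸ k)) h              ≤⟨ +-monoˡ-≤ _ (Σ<-mono (x ∘ suc) h≤ℓ∸h) ⟩
      Σ< (x ∘ suc) (ℓ ∸ h) + Σ< (λ k → x (ℓ ∸ k)) h        ≡⟨ Σ<-reverse x h≤ℓ ⟨
      Σ< (x ∘ suc) ℓ                                       ≡⟨ sum-part xs ⟨
      sum xs                                               ≡⟨ sum≡g ⟩
      g                                                    ∎
      where
      open ≤-Reasoning
      h≤ℓ∸h : h ≤ ℓ ∸ h
      h≤ℓ∸h = m+n≤o⇒m≤o∸n h (⌊n/2⌋+⌊n/2⌋≤n ℓ)
      h≤ℓ : h ≤ ℓ
      h≤ℓ = ≤-trans h≤ℓ∸h (m∸n≤m ℓ h)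
      shift : Σ< (λ k → x (ℓ ∸ suc k)) h ≤ Σ< (λ k → x (ℓ ∸ k)) h
      shift = +-cancelʳ-≤ 3 _ _ (subst (λ v → Σ< (λ k → x (ℓ ∸ suc k)) h + v ≤ Σ< (λ k → x (ℓ ∸ k)) h + 3) last≡3
        (≤-trans (≤-reflexive (Σ<-suc (λ k → x (ℓ ∸ k)) h)) (+-monoʳ-≤ (Σ< (λ k → x (ℓ ∸ k)) h) (x≤3 (ℓ ∸ h)))))

    ℓ≤g : ℓ ≤ g
    ℓ≤g = subst (ℓ ≤_) sum≡g (length≤sum xs positive)

  -- As ℓ ≤ 2h + 1, every position before the last occurs in some pair, and the last part is 3. The
  -- length belongs to the code since ℓ = 2h and ℓ = 2h + 1 give equally many pairs.
  pairList-injective : ∀ {g xs ys} → Valid g xs → Valid g ys →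
                       length xs ≡ length ys → pairList xs ≡ pairList ys → xs ≡ ys
  pairList-injective {g} {xs} {ys} vx vy len eq = part-ext xs ys len same
    where
    module X = ValidWord vx
    module Y = ValidWord vy
    ℓ h : ℕ
    ℓ = length xs
    h = ⌊ ℓ /2⌋

    pairs≡ : ∀ t → t < h → pairsOf xs t ≡ pairsOf ys t
    pairs≡ = applyFrom-injective 0 h (trans eq (cong (λ n → applyFrom (pairsOf ys) 0 ⌊ n /2⌋) (sym len)))

    left : ∀ t → t < h → part xs (suc t) ≡ part ys (suc t)
    left t t<h = trans (sym (X.value-left t<h))
      (trans (cong (value ∘ proj₁) (pairs≡ t t<h)) (Y.value-left (subst (λ n → t < ⌊ n /2⌋) len t<h)))

    right : ∀ t → t < h → part xs (ℓ ∸ suc t) ≡ part ys (ℓ ∸ suc t)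
    right t t<h = trans (sym (X.value-right t<h))
      (trans (cong (value ∘ proj₂) (pairs≡ t t<h))
        (trans (Y.value-right (subst (λ n → t < ⌊ n /2⌋) len t<h)) (cong (λ n → part ys (n ∸ suc t)) (sym len))))

    same : ∀ r → 1 ≤ r → r ≤ ℓ → part xs r ≡ part ys r
    same (suc r) _ r<ℓ with r <? h | m≤n⇒m<n∨m≡n r<ℓ
    ... | yes r<h | _          = left r r<h
    ... | no _    | inj₂ r≡ℓ   = trans (cong (part xs) r≡ℓ) (trans X.last≡3
                                   (sym (trans (cong (part ys) (trans r≡ℓ len)) Y.last≡3)))
    ... | no r≮h  | inj₁ r<ℓ-1 = subst (λ k → part xs k ≡ part ys k)
          (trans (cong (ℓ ∸_) eq-t) (m∸[m∸n]≡n r<ℓ)) (right (ℓ ∸ suc (suc r)) t<h)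
      where
      eq-t : suc (ℓ ∸ suc (suc r)) ≡ ℓ ∸ suc r
      eq-t = sym (+-∸-assoc 1 r<ℓ-1)
      t<h : ℓ ∸ suc (suc r) < h
      t<h = begin
        suc (ℓ ∸ suc (suc r))          ≡⟨ eq-t ⟩
        ℓ ∸ suc r                      ≤⟨ ∸-mono (n≤1+⌊n/2⌋+⌊n/2⌋ ℓ) (s≤s (≮⇒≥ r≮h)) ⟩
        (h + h) ∸ h                    ≡⟨ m+n∸m≡n h h ⟩
        h                              ∎
        where open ≤-Reasoning

  codesFrom : ℕ → ℕ → List (ℕ × List Pair)
  codesFrom ℓ i = map (ℓ ,_) (continuations ⌊ ℓ /2⌋ (initialQueue i))

  -- The range of i is made independent of ℓ. For i ≥ ⌊ℓ/2⌋ only `start` states get used and the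
  -- same codes recur, which merely enlarges the sum bounded below.
  codesOfLength : ℕ → ℕ → List (ℕ × List Pair)
  codesOfLength g ℓ = concatMap (codesFrom ℓ) (upTo (suc g))

  codes : ℕ → List (ℕ × List Pair)
  codes g = concatMap (codesOfLength g) (upTo (suc g))

  validWords-weighted : ∀ g →
    fromℕ (length (validWords g)) ℚ.* 𝕢 ^ℚ g ℚ.≤ fromℕ (suc g) ℚ.* (fromℕ (suc g) ℚ.* 1ℚ)
  validWords-weighted g = ℚ.≤-trans
      (unique-code⇒sumOver≥ {f = weight ∘ proj₂} (λ xs → length xs , pairList xs) {ys = codes g} (validWords-unique g)
        (λ xs∈ → into (validWords-sound g xs∈))
        (λ xs∈ ys∈ eq → pairList-injective (validWords-sound g xs∈) (validWords-sound g ys∈) (cong proj₁ eq) (cong proj₂ eq))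
        (0≤weight ∘ proj₂))
      bound
    where
    into : ∀ {xs} → Valid g xs → (length xs , pairList xs) ∈ˡ codes g × 𝕢 ^ℚ g ℚ.≤ weight (pairList xs)
    into {xs} v with ValidWord.pairList-∈ v
    ... | i , i≤h , ∈c =
        ∈-concatMap⁺ (codesOfLength g) (Any.map (λ { refl → ∈-concatMap⁺ (codesFrom (length xs)) (Any.map (λ { refl → ∈-map⁺ (length xs ,_) ∈c })
          (∈-upTo⁺ (s≤s (≤-trans i≤h (≤-trans (⌊n/2⌋≤n (length xs)) ℓ≤g))))) }) (∈-upTo⁺ (s≤s ℓ≤g)))
      , ^-antimono 0≤𝕢 (ℚ.≤ᵇ⇒≤ _) total≤g
      where open ValidWord v

    sumOver-map : ∀ (ℓ : ℕ) pss → sumOver (weight ∘ proj₂) (map (ℓ ,_) pss) ≡ sumOver weight pss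
    sumOver-map ℓ []         = refl
    sumOver-map ℓ (ps ∷ pss) = cong (weight ps ℚ.+_) (sumOver-map ℓ pss)

    single : ∀ ℓ i → sumOver (weight ∘ proj₂) (codesFrom ℓ i) ℚ.≤ 1ℚ
    single ℓ i = ℚ.≤-trans (ℚ.≤-reflexive (sumOver-map ℓ (continuations ⌊ ℓ /2⌋ (initialQueue i))))
      (ℚ.≤-trans (continuations-weight ⌊ ℓ /2⌋ (initialQueue i)) (ℚ.≤-reflexive (initialQueue-potential ⌊ ℓ /2⌋ i)))

    sum-upTo : ∀ {f : ℕ → ℚ} {c} → (∀ i → f i ℚ.≤ c) → sumOver f (upTo (suc g)) ℚ.≤ fromℕ (suc g) ℚ.* c
    sum-upTo {f} {c} f≤c = subst (λ n → sumOver f (upTo (suc g)) ℚ.≤ fromℕ n ℚ.* c) (length-upTo (suc g))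
      (sumOver-bounded f≤c (upTo (suc g)))

    bound : sumOver (weight ∘ proj₂) (codes g) ℚ.≤ fromℕ (suc g) ℚ.* (fromℕ (suc g) ℚ.* 1ℚ)
    bound = ℚ.≤-trans (ℚ.≤-reflexive (sumOver-concatMap (weight ∘ proj₂) (codesOfLength g) (upTo (suc g))))
      (sum-upTo λ ℓ → ℚ.≤-trans (ℚ.≤-reflexive (sumOver-concatMap (weight ∘ proj₂) (codesFrom ℓ) (upTo (suc g))))
        (sum-upTo (single ℓ)))

-- From the weighted count to the growth rate

module Growth where

  import Data.Nat.Base as ℕ
  import Data.Nat.Properties as ℕ
  open import Data.Nat.Base using (ℕ; zero; suc)
  import Data.Integer.Base as ℤ
  import Data.Integer.Properties as ℤ
  import Data.Nat.Coprimality as Coprime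
  open import Data.Rational.Base
  open import Data.Rational.Properties
  open import Data.Rational.Solver using (module +-*-Solver)
  open import Algebra.Definitions.RawSemiring +-*-rawSemiring using (_^_)
  open import Data.Product.Base using (∃-syntax; _×_; _,_; proj₁; proj₂)
  open import Data.Sum.Base using (inj₂)
  open import Relation.Binary.PropositionalEquality
  open import Relation.Nullary.Decidable using (True; toWitness)
  open WeightedSums
  open Transfer using (𝕢)

  decide-< : ∀ {p q} {_ : True (p <? q)} → p < q
  decide-< {p} {q} {t} = toWitness {a? = p <? q} t

  ^-* : ∀ p q n → (p * q) ^ n ≡ p ^ n * q ^ n
  ^-* p q zero    = refl
  ^-* p q (suc n) = trans (cong (p * q *_) (^-* p q n))
    (solve 4 (λ p q a b → p :* q :* (a :* b) := p :* a :* (q :* b)) refl p q (p ^ n) (q ^ n))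
    where open +-*-Solver

  1^ : ∀ n → 1ℚ ^ n ≡ 1ℚ
  1^ zero    = refl
  1^ (suc n) = trans (*-identityˡ (1ℚ ^ n)) (1^ n)

  ^-monoˡ-≤ : ∀ {p q} n → 0ℚ ≤ p → p ≤ q → p ^ n ≤ q ^ n
  ^-monoˡ-≤ zero    _   _   = ≤-refl
  ^-monoˡ-≤ (suc n) 0≤p p≤q = *-mono-≤ (0≤^ n 0≤p) (≤-trans 0≤p p≤q) p≤q (^-monoˡ-≤ n 0≤p p≤q)

  bernoulli : ∀ {δ} → 0ℚ ≤ δ → ∀ n → 1ℚ + fromℕ n * δ ≤ (1ℚ + δ) ^ n
  bernoulli {δ} _   zero    = ≤-reflexive (trans (cong (1ℚ +_) (*-zeroˡ δ)) (+-identityʳ 1ℚ))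
  bernoulli {δ} 0≤δ (suc n) = begin
    1ℚ + fromℕ (suc n) * δ                   ≡⟨ cong (λ k → 1ℚ + k * δ) (fromℕ-suc n) ⟩
    1ℚ + (1ℚ + N) * δ                        ≡⟨ +-identityʳ _ ⟨
    1ℚ + (1ℚ + N) * δ + 0ℚ
      ≤⟨ +-monoʳ-≤ (1ℚ + (1ℚ + N) * δ) (0≤* (0≤* (fromℕ-nonNeg n) 0≤δ) 0≤δ) ⟩
    1ℚ + (1ℚ + N) * δ + N * δ * δ
      ≡⟨ solve 2 (λ N δ → con 1ℚ :+ (con 1ℚ :+ N) :* δ :+ N :* δ :* δ
           := (con 1ℚ :+ δ) :* (con 1ℚ :+ N :* δ)) refl N δ ⟩
    (1ℚ + δ) * (1ℚ + N * δ)                  ≤⟨ *-monoˡ-≤-nonNeg (1ℚ + δ) {{nonNegative (0≤+ 0≤1 0≤δ)}} (bernoulli 0≤δ n) ⟩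
    (1ℚ + δ) * (1ℚ + δ) ^ n                  ∎
    where
    open ≤-Reasoning
    open +-*-Solver
    N = fromℕ n

  fromℕ-mono : ∀ {m n} → m ℕ.≤ n → fromℕ m ≤ fromℕ n
  fromℕ-mono {n = n} ℕ.z≤n = fromℕ-nonNeg n
  fromℕ-mono {suc m} {suc n} (ℕ.s≤s m≤n) =
    subst₂ _≤_ (sym (fromℕ-suc m)) (sym (fromℕ-suc n)) (+-monoʳ-≤ 1ℚ (fromℕ-mono m≤n))

  p≤fromℕ : ∀ p → ∃[ n ] p ≤ fromℕ n
  p≤fromℕ p@(mkℚ i d _) = ℤ.∣ i ∣ , subst (p ≤_) (sym (↥p/↧p≡p q)) (*≤* le)
    where
    q : ℚ
    q = mkℚ (ℤ.+ ℤ.∣ i ∣) 0 (Coprime.sym (Coprime.1-coprimeTo ℤ.∣ i ∣))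
    i≤∣i∣ : ∀ i → i ℤ.≤ ℤ.+ ℤ.∣ i ∣
    i≤∣i∣ (ℤ.+ n)      = ℤ.≤-refl
    i≤∣i∣ (ℤ.-[1+ n ]) = ℤ.-≤+
    le : i ℤ.* ℤ.1ℤ ℤ.≤ ℤ.+ ℤ.∣ i ∣ ℤ.* ℤ.+ suc d
    le = subst₂ ℤ._≤_ (sym (ℤ.*-identityʳ i)) (ℤ.pos-* ℤ.∣ i ∣ (suc d))
      (ℤ.≤-trans (i≤∣i∣ i) (ℤ.+≤+ (ℕ.m≤m*n ℤ.∣ i ∣ (suc d))))

  reciprocal : ∀ {p} → 0ℚ < p → ∃[ r ] 0ℚ < r × r * p ≡ 1ℚ
  reciprocal {p} 0<p = 1/ p , positive⁻¹ (1/ p) {{1/pos⇒pos p}} , *-inverseˡ p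
    where instance
      p-positive = positive 0<p
      p-nonZero  = pos⇒nonZero p

  archimedean : ∀ K {η} → 0ℚ < η → ∃[ n ] K ≤ fromℕ n * η
  archimedean K {η} 0<η with reciprocal 0<η
  ... | r , _ , rη≡1 with p≤fromℕ (K * r)
  ... | n , le = n , (begin
      K               ≡⟨ *-identityʳ K ⟨
      K * 1ℚ          ≡⟨ cong (K *_) rη≡1 ⟨
      K * (r * η)     ≡⟨ *-assoc K r η ⟨
      K * r * η       ≤⟨ *-monoʳ-≤-nonNeg η {{nonNegative (<⇒≤ 0<η)}} le ⟩
      fromℕ n * η     ∎)
    where open ≤-Reasoning

  power-unbounded : ∀ K {δ ε} → 0ℚ < δ → 0ℚ < ε → ∃[ N ] ∀ n → N ℕ.≤ n → K ≤ ε * (1ℚ + δ) ^ n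
  power-unbounded K {δ} {ε} 0<δ 0<ε = N , λ n N≤n → begin
      K                         ≤⟨ proj₂ arch ⟩
      fromℕ N * (δ * ε)         ≡⟨ solve 3 (λ n d e → n :* (d :* e) := e :* (n :* d)) refl (fromℕ N) δ ε ⟩
      ε * (fromℕ N * δ)         ≤⟨ *-monoˡ-≤-nonNeg ε {{nonNegative (<⇒≤ 0<ε)}} (begin
        fromℕ N * δ               ≤⟨ *-monoʳ-≤-nonNeg δ {{nonNegative (<⇒≤ 0<δ)}} (fromℕ-mono N≤n) ⟩
        fromℕ n * δ               ≡⟨ +-identityˡ _ ⟨
        0ℚ + fromℕ n * δ          ≤⟨ +-monoˡ-≤ (fromℕ n * δ) 0≤1 ⟩
        1ℚ + fromℕ n * δ          ≤⟨ bernoulli (<⇒≤ 0<δ) n ⟩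
        (1ℚ + δ) ^ n              ∎) ⟩
      ε * (1ℚ + δ) ^ n          ∎
    where
    open ≤-Reasoning
    open +-*-Solver
    0<δε : 0ℚ < δ * ε
    0<δε = subst (_< δ * ε) (*-zeroʳ δ) (*-monoʳ-<-pos δ {{positive 0<δ}} 0<ε)
    arch = archimedean K 0<δε
    N = proj₁ arch

  -- The factor β² in τ absorbs (g + 1)²; β is so close to 1 that β τ < ω and θ β < 1 with 31/50 > 1/ω.
  δ₀ β τ θ M : ℚ
  δ₀ = ℤ.+ 1 / 500
  β = 1ℚ + δ₀
  τ = ℤ.+ 8 / 5 * (β * β)
  θ = τ * (ℤ.+ 31 / 50)
  M = fromℕ 500 * fromℕ 500

  0≤δ₀ : 0ℚ ≤ δ₀
  0≤δ₀ = ≤ᵇ⇒≤ _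

  0≤τ : 0ℚ ≤ τ
  0≤τ = ≤ᵇ⇒≤ _

  0≤θ : 0ℚ ≤ θ
  0≤θ = ≤ᵇ⇒≤ _

  0≤M : 0ℚ ≤ M
  0≤M = ≤ᵇ⇒≤ _

  -- Bernoulli's inequality at rate 1/500: g + 1 ≤ 500 + g = 500 (1 + g/500).
  fromℕ-suc≤ : ∀ g → fromℕ (suc g) ≤ fromℕ 500 * β ^ g
  fromℕ-suc≤ g = begin
    fromℕ (suc g)                        ≡⟨ fromℕ-suc g ⟩
    1ℚ + fromℕ g                         ≤⟨ +-monoˡ-≤ (fromℕ g) {1ℚ} {fromℕ 500} (≤ᵇ⇒≤ _) ⟩
    fromℕ 500 + fromℕ g
      ≡⟨ solve 1 (λ G → con (fromℕ 500) :+ G := con (fromℕ 500) :* (con 1ℚ :+ G :* con δ₀)) refl (fromℕ g) ⟩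
    fromℕ 500 * (1ℚ + fromℕ g * δ₀)      ≤⟨ *-monoˡ-≤-nonNeg (fromℕ 500) (bernoulli 0≤δ₀ g) ⟩
    fromℕ 500 * β ^ g                    ∎
    where
    open ≤-Reasoning
    open +-*-Solver

  -- Each factor g + 1 costs 500 β^g, whence M = 500² and β² in τ; multiplying by (8/5)^g cancels
  -- the weight.
  absorb-polynomial : ∀ g {c} → c * 𝕢 ^ g ≤ fromℕ (suc g) * (fromℕ (suc g) * 1ℚ) → c ≤ M * τ ^ g
  absorb-polynomial g {c} le = begin
    c                                                ≡⟨ *-identityʳ c ⟨
    c * 1ℚ                                           ≡⟨ cong (c *_) (trans (sym (^-* 𝕢 s g)) (1^ g)) ⟨
    c * (𝕢 ^ g * s ^ g)                              ≡⟨ *-assoc c (𝕢 ^ g) (s ^ g) ⟨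
    c * 𝕢 ^ g * s ^ g
      ≤⟨ *-monoʳ-≤-nonNeg (s ^ g) {{nonNegative 0≤s^g}} (≤-trans le square≤) ⟩
    fromℕ 500 * B * (fromℕ 500 * B) * s ^ g
      ≡⟨ solve 3 (λ k b s → k :* b :* (k :* b) :* s := k :* k :* (s :* (b :* b))) refl (fromℕ 500) B (s ^ g) ⟩
    M * (s ^ g * (B * B))
      ≡⟨ cong (M *_) (trans (^-* s (β * β) g) (cong (s ^ g *_) (^-* β β g))) ⟨
    M * τ ^ g                                        ∎
    where
    open ≤-Reasoning
    open +-*-Solver
    s = ℤ.+ 8 / 5
    B = β ^ g
    0≤s^g : 0ℚ ≤ s ^ g
    0≤s^g = 0≤^ g (≤ᵇ⇒≤ _)
    square≤ : fromℕ (suc g) * (fromℕ (suc g) * 1ℚ) ≤ fromℕ 500 * B * (fromℕ 500 * B)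
    square≤ = subst (λ k → fromℕ (suc g) * k ≤ fromℕ 500 * B * (fromℕ 500 * B)) (sym (*-identityʳ _))
      (*-mono-≤ (fromℕ-nonNeg (suc g)) (≤-trans (fromℕ-nonNeg (suc g)) (fromℕ-suc≤ g)) (fromℕ-suc≤ g) (fromℕ-suc≤ g))

  limsup<ω : ∀ (c : ℕ → ℕ) → (∀ n → fromℕ (c n) ≤ M * τ ^ n) → limsup (λ n → root (suc n) (c (suc n))) <ᵁ ω
  -- 1.61 < 1.612 < 1.615 < ω: the n-th root is bounded by the first, and the openness of the cut of
  -- the root and of that of the limsup each take one more gap.
  limsup<ω c c≤ = ℤ.+ 323 / 200
      , (ℤ.+ 403 / 250 , decide-< , N , λ n N≤n →
          ℤ.+ 161 / 100 , decide-< , ≤ᵇ⇒≤ _ , le (suc n) (ℕ.m≤n⇒m≤1+n N≤n))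
      -- 1.615 < ω amounts to 2 · 1.615 - 1 = 2.23 < √5, witnessed by 2.235, whose square is
      -- 4.995225.
      , ℤ.+ 447 / 200 , decide-< , inj₂ (≤ᵇ⇒≤ _)
      where
      -- A further factor β^n outgrows the constant M; β τ is about 1.6096, still below 1.61.
      large = power-unbounded M {δ₀} {1ℚ} decide-< decide-<
      N = proj₁ large
      le : ∀ n → N ℕ.≤ n → fromℕ (c n) ≤ (ℤ.+ 161 / 100) ^ n
      le n N≤n = begin
        fromℕ (c n)             ≤⟨ c≤ n ⟩
        M * τ ^ n               ≤⟨ *-monoʳ-≤-nonNeg (τ ^ n) {{nonNegative (0≤^ n 0≤τ)}} (proj₂ large n N≤n) ⟩
        1ℚ * β ^ n * τ ^ n      ≡⟨ cong (_* τ ^ n) (*-identityˡ (β ^ n)) ⟩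
        β ^ n * τ ^ n           ≡⟨ ^-* β τ n ⟨
        (β * τ) ^ n             ≤⟨ ^-monoˡ-≤ n (≤ᵇ⇒≤ _) (≤ᵇ⇒≤ _) ⟩
        (ℤ.+ 161 / 100) ^ n     ∎
        where open ≤-Reasoning

-- Convergence of a power series with geometrically bounded coefficients

module Convergence where

  import Data.Nat.Base as ℕ
  import Data.Nat.Properties as ℕ
  open import Data.Nat.Base using (ℕ; zero; suc)
  import Data.Integer.Base as ℤ
  open import Data.Rational.Base
  open import Data.Rational.Properties
  open import Data.Rational.Solver using (module +-*-Solver)
  open import Algebra.Definitions.RawSemiring +-*-rawSemiring using (_^_)
  open import Data.Empty using (⊥-elim)
  open import Data.Product.Base using (∃-syntax; _×_; _,_; proj₁; proj₂)
  open import Data.Sum.Base using (inj₁; inj₂)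
  open import Relation.Binary.PropositionalEquality
  open import Relation.Nullary using (yes; no)
  open WeightedSums
  open Growth

  0≤p*p : ∀ p → 0ℚ ≤ p * p
  0≤p*p p with ≤-total 0ℚ p
  ... | inj₁ 0≤p = 0≤* 0≤p 0≤p
  ... | inj₂ p≤0 = subst (0ℚ ≤_) (solve 1 (λ p → :- p :* :- p := p :* p) refl p) (0≤* 0≤-p 0≤-p)
    where
    open +-*-Solver
    0≤-p : 0ℚ ≤ - p
    0≤-p = neg-antimono-≤ p≤0

  *-self-cancel-≤ : ∀ {p q} → 0ℚ ≤ q → p * p ≤ q * q → p ≤ q
  *-self-cancel-≤ {p} {q} 0≤q pp≤qq with p ≤? q
  ... | yes p≤q = p≤q
  ... | no  p≰q = ⊥-elim (<-irrefl refl (<-≤-trans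
      (≤-<-trans (*-monoˡ-≤-nonNeg q {{nonNegative 0≤q}} (<⇒≤ q<p))
        (*-monoˡ-<-pos p {{positive (≤-<-trans 0≤q q<p)}} q<p)) pp≤qq))
    where q<p = ≰⇒> p≰q

  -- |z| ≤ α in squared form, as moduli of rational complex numbers need not be rational; α ≥ 0 is
  -- recorded so that bounds can be added and multiplied.
  record Bounded (z : ℚ[i]) (α : ℚ) : Set where
    constructor bounded
    field
      0≤bound : 0ℚ ≤ α
      normSq≤ : normSq z ≤ α * α

  open Bounded

  bounded-weaken : ∀ {z α β} → α ≤ β → Bounded z α → Bounded z β
  bounded-weaken α≤β (bounded 0≤α le) = bounded (≤-trans 0≤α α≤β) (≤-trans le (*-mono-≤ 0≤α (≤-trans 0≤α α≤β) α≤β α≤β))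

  bounded-⊕ : ∀ {z w α β} → Bounded z α → Bounded w β → Bounded (z ⊕ w) (α + β)
  bounded-⊕ {a +i b} {c +i d} {α} {β} (bounded 0≤α z≤) (bounded 0≤β w≤) = bounded (0≤+ 0≤α 0≤β) (begin
    normSq ((a +i b) ⊕ (c +i d))
      ≡⟨ solve 4 (λ a b c d → (a :+ c) :* (a :+ c) :+ (b :+ d) :* (b :+ d)
           := a :* a :+ b :* b :+ (c :* c :+ d :* d) :+ (a :* c :+ b :* d :+ (a :* c :+ b :* d))) refl a b c d ⟩
    normSq (a +i b) + normSq (c +i d) + (ip + ip)
      ≤⟨ +-mono-≤ (+-mono-≤ z≤ w≤) (+-mono-≤ ip≤ ip≤) ⟩
    α * α + β * β + (α * β + α * β)
      ≡⟨ solve 2 (λ a b → a :* a :+ b :* b :+ (a :* b :+ a :* b) := (a :+ b) :* (a :+ b)) refl α β ⟩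
    (α + β) * (α + β) ∎)
    where
    open ≤-Reasoning
    open +-*-Solver
    ip cross : ℚ
    ip    = a * c + b * d
    cross = a * d - b * c
    -- Cauchy–Schwarz.
    ip≤ : ip ≤ α * β
    ip≤ = *-self-cancel-≤ (0≤* 0≤α 0≤β) (begin
      ip * ip                              ≤⟨ p≤q+p (0≤p*p cross) ⟩
      cross * cross + ip * ip
        ≡⟨ solve 4 (λ a b c d → (a :* d :- b :* c) :* (a :* d :- b :* c) :+ (a :* c :+ b :* d) :* (a :* c :+ b :* d)
                                                := (a :* a :+ b :* b) :* (c :* c :+ d :* d)) refl a b c d ⟩
      normSq (a +i b) * normSq (c +i d)    ≤⟨ *-mono-≤ (0≤+ (0≤p*p c) (0≤p*p d)) (0≤p*p α) z≤ w≤ ⟩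
      α * α * (β * β)
        ≡⟨ solve 2 (λ a b → a :* a :* (b :* b) := a :* b :* (a :* b)) refl α β ⟩
      α * β * (α * β)                      ∎)

  bounded-⊗ : ∀ {z w α β} → Bounded z α → Bounded w β → Bounded (z ⊗ w) (α * β)
  bounded-⊗ {a +i b} {c +i d} {α} {β} (bounded 0≤α z≤) (bounded 0≤β w≤) = bounded (0≤* 0≤α 0≤β) (begin
    normSq ((a +i b) ⊗ (c +i d))
      ≡⟨ solve 4 (λ a b c d → (a :* c :- b :* d) :* (a :* c :- b :* d) :+ (a :* d :+ b :* c) :* (a :* d :+ b :* c)
           := (a :* a :+ b :* b) :* (c :* c :+ d :* d)) refl a b c d ⟩
    normSq (a +i b) * normSq (c +i d)    ≤⟨ *-mono-≤ (0≤+ (0≤p*p c) (0≤p*p d)) (0≤p*p α) z≤ w≤ ⟩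
    α * α * (β * β)
      ≡⟨ solve 2 (λ a b → a :* a :* (b :* b) := a :* b :* (a :* b)) refl α β ⟩
    α * β * (α * β)                      ∎)
    where
    open ≤-Reasoning
    open +-*-Solver

  bounded-real : ∀ {p} → 0ℚ ≤ p → Bounded (p +i 0ℚ) p
  bounded-real {p} 0≤p = bounded 0≤p (≤-reflexive (solve 1 (λ p → p :* p :+ con 0ℚ :* con 0ℚ := p :* p) refl p))
    where open +-*-Solver

  bounded-⊖-sym : ∀ z w {α} → Bounded (z ⊖ w) α → Bounded (w ⊖ z) α
  bounded-⊖-sym (a +i b) (c +i d) (bounded 0≤α le) = bounded 0≤α (subst (_≤ _)
    (solve 4 (λ a b c d → (a :- c) :* (a :- c) :+ (b :- d) :* (b :- d)
      := (c :- a) :* (c :- a) :+ (d :- b) :* (d :- b)) refl a b c d) le)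
    where open +-*-Solver

  bounded-self-⊖ : ∀ z → Bounded (z ⊖ z) 0ℚ
  bounded-self-⊖ (a +i b) = bounded ≤-refl (≤-reflexive
    (solve 2 (λ a b → (a :- a) :* (a :- a) :+ (b :- b) :* (b :- b) := con 0ℚ :* con 0ℚ) refl a b))
    where open +-*-Solver

  bounded-↑ : ∀ {z ρ} n → Bounded z ρ → Bounded (z ↑ n) (ρ ^ n)
  bounded-↑ zero    _ = bounded-real 0≤1
  bounded-↑ {z} (suc n) b = bounded-⊗ b (bounded-↑ n b)

  ⊖-telescope : ∀ u v w → (u ⊖ v) ⊕ (v ⊖ w) ≡ u ⊖ w
  ⊖-telescope (a +i b) (c +i d) (e +i f) = cong₂ _+i_ (eq a c e) (eq b d f)
    where
    open +-*-Solver
    eq : ∀ a c e → (a - c) + (c - e) ≡ a - e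
    eq = solve 3 (λ a c e → (a :- c) :+ (c :- e) := a :- e) refl

  ⊕-⊖-assoc : ∀ u v w → (u ⊖ w) ⊕ v ≡ (u ⊕ v) ⊖ w
  ⊕-⊖-assoc (a +i b) (c +i d) (e +i f) = cong₂ _+i_ (eq a c e) (eq b d f)
    where
    open +-*-Solver
    eq : ∀ a c e → (a - e) + c ≡ (a + c) - e
    eq = solve 3 (λ a c e → (a :- e) :+ c := (a :+ c) :- e) refl

  ⊕-⊖-interchange : ∀ u v w k y → (u ⊖ v) ⊕ (k ⊗ (w ⊖ y)) ≡ (u ⊕ k ⊗ w) ⊖ (v ⊕ k ⊗ y)
  ⊕-⊖-interchange (a +i b) (c +i d) (e +i f) (g +i h) (i +i j) = cong₂ _+i_
    (solve 8 (λ a c g h e f i j → (a :- c) :+ (g :* (e :- i) :- h :* (f :- j))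
       := (a :+ (g :* e :- h :* f)) :- (c :+ (g :* i :- h :* j))) refl a c g h e f i j)
    (solve 8 (λ b d g h e f i j → (b :- d) :+ (g :* (f :- j) :+ h :* (e :- i))
       := (b :+ (g :* f :+ h :* e)) :- (d :+ (g :* j :+ h :* i))) refl b d g h e f i j)
    where open +-*-Solver

  ⊗-⊖-⊗ : ∀ z w u v → z ⊗ (u ⊖ v) ⊕ (z ⊖ w) ⊗ v ≡ z ⊗ u ⊖ w ⊗ v
  ⊗-⊖-⊗ (a +i b) (c +i d) (e +i f) (g +i h) = cong₂ _+i_
    (solve 8 (λ a b c d e f g h → (a :* (e :- g) :- b :* (f :- h)) :+ ((a :- c) :* g :- (b :- d) :* h)
       := (a :* e :- b :* f) :- (c :* g :- d :* h)) refl a b c d e f g h)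
    (solve 8 (λ a b c d e f g h → (a :* (f :- h) :+ b :* (e :- g)) :+ ((a :- c) :* h :+ (b :- d) :* g)
       := (a :* f :+ b :* e) :- (c :* h :+ d :* g)) refl a b c d e f g h)
    where open +-*-Solver

  -- Induction through z^(n+1) - w^(n+1) = z (z^n - w^n) + (z - w) w^n on the closed unit disc.
  bounded-↑-⊖ : ∀ {z w δ} → Bounded z 1ℚ → Bounded w 1ℚ → Bounded (z ⊖ w) δ →
                ∀ n → Bounded (z ↑ n ⊖ w ↑ n) (fromℕ n * δ)
  bounded-↑-⊖ {δ = δ} _ _ _ zero = subst (Bounded _) (sym (*-zeroˡ δ)) (bounded-self-⊖ (1ℚ +i 0ℚ))
  bounded-↑-⊖ {z} {w} {δ} bz bw bzw (suc n) = subst₂ Bounded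
    (⊗-⊖-⊗ z w (z ↑ n) (w ↑ n)) bound
    (bounded-⊕
      (bounded-⊗ bz (bounded-↑-⊖ bz bw bzw n)) (bounded-⊗ bzw (bounded-↑ n bw)))
    where
    open ≡-Reasoning
    bound : 1ℚ * (fromℕ n * δ) + δ * 1ℚ ^ n ≡ fromℕ (suc n) * δ
    bound = begin
      1ℚ * (fromℕ n * δ) + δ * 1ℚ ^ n
        ≡⟨ cong₂ _+_ (*-identityˡ (fromℕ n * δ)) (trans (cong (δ *_) (1^ n)) (*-identityʳ δ)) ⟩
      fromℕ n * δ + δ                  ≡⟨ +-comm (fromℕ n * δ) δ ⟩
      δ + fromℕ n * δ                  ≡⟨ fromℕ-suc-* n δ ⟨
      fromℕ (suc n) * δ                ∎

  -- The point of evaluation is itself a Cauchy sequence, so a partial sum has to be compared at two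
  -- approximations. The constant C is the sum of g · c g over the terms involved.
  partialSum-lipschitz : ∀ c n → ∃[ C ] 0ℚ ≤ C × (∀ {z w δ} → Bounded z 1ℚ → Bounded w 1ℚ → Bounded (z ⊖ w) δ →
                         Bounded (partialSum c z n ⊖ partialSum c w n) (C * δ))
  partialSum-lipschitz c zero = 0ℚ , ≤-refl , λ {_} {_} {δ} _ _ _ →
    subst (Bounded _) (sym (*-zeroˡ δ)) (bounded-self-⊖ (0ℚ +i 0ℚ))
  partialSum-lipschitz c (suc n) = C + K , 0≤+ 0≤C 0≤K , λ {z} {w} {δ} bz bw bzw →
    subst₂ Bounded
      (⊕-⊖-interchange (partialSum c z n) (partialSum c w n) (z ↑ (3 ℕ.+ n)) (a +i 0ℚ) (w ↑ (3 ℕ.+ n)))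
      (solve 4 (λ C a b δ → C :* δ :+ a :* (b :* δ) := (C :+ a :* b) :* δ) refl C a (fromℕ (3 ℕ.+ n)) δ)
      (bounded-⊕
        (lip bz bw bzw)
        (bounded-⊗ (bounded-real 0≤a) (bounded-↑-⊖ bz bw bzw (3 ℕ.+ n))))
    where
    open +-*-Solver
    ih = partialSum-lipschitz c n
    C = proj₁ ih
    0≤C = proj₁ (proj₂ ih)
    lip = proj₂ (proj₂ ih)
    a = fromℕ (c (3 ℕ.+ n))
    0≤a = fromℕ-nonNeg (c (3 ℕ.+ n))
    K = a * fromℕ (3 ℕ.+ n)
    0≤K : 0ℚ ≤ K
    0≤K = 0≤* 0≤a (fromℕ-nonNeg (3 ℕ.+ n))

  -- Geometric majorant with ratio τ ρ₀. The number B stands for M / (1 - τ ρ₀), given by an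
  -- inequality in place of a division.
  module PowerSeries (c : ℕ → ℕ) {M τ ρ₀ B : ℚ} (0≤M : 0ℚ ≤ M) (0≤τ : 0ℚ ≤ τ) (0≤ρ₀ : 0ℚ ≤ ρ₀) (ρ₀≤1 : ρ₀ ≤ 1ℚ)
    (τρ₀≤1 : τ * ρ₀ ≤ 1ℚ) (0≤B : 0ℚ ≤ B) (M≤ : M ≤ B * (1ℚ - τ * ρ₀))
    (c≤ : ∀ n → fromℕ (c n) ≤ M * τ ^ n)
    (small : ∀ ε → 0ℚ < ε → Eventually λ n → B * (τ * ρ₀) ^ n ≤ ε) where

    private
      ϑ : ℚ
      ϑ = τ * ρ₀
      0≤ϑ : 0ℚ ≤ ϑ
      0≤ϑ = 0≤* 0≤τ 0≤ρ₀
      P : ℚ[i] → ℕ → ℚ[i]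
      P = partialSum c
      term : ℚ[i] → ℕ → ℚ[i]
      term z n = (fromℕ (c (3 ℕ.+ n)) +i 0ℚ) ⊗ z ↑ (3 ℕ.+ n)

    bounded-term : ∀ {z} → Bounded z ρ₀ → ∀ n → Bounded (term z n) (M * ϑ ^ n)
    bounded-term {z} bz n = bounded-weaken (begin
      fromℕ (c k) * ρ₀ ^ k      ≤⟨ *-monoʳ-≤-nonNeg (ρ₀ ^ k) {{nonNegative (0≤^ k 0≤ρ₀)}} (c≤ k) ⟩
      M * τ ^ k * ρ₀ ^ k        ≡⟨ *-assoc M (τ ^ k) (ρ₀ ^ k) ⟩
      M * (τ ^ k * ρ₀ ^ k)      ≡⟨ cong (M *_) (^-* τ ρ₀ k) ⟨
      M * ϑ ^ k
        ≤⟨ *-monoˡ-≤-nonNeg M {{nonNegative 0≤M}} (^-antimono 0≤ϑ τρ₀≤1 (ℕ.m≤n+m n 3)) ⟩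
      M * ϑ ^ n                 ∎)
      (bounded-⊗ (bounded-real (fromℕ-nonNeg (c k))) (bounded-↑ k bz))
      where
      open ≤-Reasoning
      k = 3 ℕ.+ n

    -- By the hypothesis on B, M ϑ^m ≤ B ϑ^m - B ϑ^(m+1), so the change of the subtracted term pays
    -- for each new summand.
    bounded-tail : ∀ {z} → Bounded z ρ₀ → ∀ n d → Bounded (P z (d ℕ.+ n) ⊖ P z n) (B * ϑ ^ n - B * ϑ ^ (d ℕ.+ n))
    bounded-tail {z} bz n zero = subst (Bounded _) (sym (+-inverseʳ (B * ϑ ^ n))) (bounded-self-⊖ (P z n))
    bounded-tail {z} bz n (suc d) = subst (λ u → Bounded u (X - B * ϑ ^ suc m)) (⊕-⊖-assoc (P z m) (term z m) (P z n))
      (bounded-weaken bound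
        (bounded-⊕ (bounded-tail bz n d) (bounded-term bz m)))
      where
      open ≤-Reasoning
      open +-*-Solver
      m = d ℕ.+ n
      X = B * ϑ ^ n
      bound : X - B * ϑ ^ m + M * ϑ ^ m ≤ X - B * ϑ ^ suc m
      bound = begin
        X - B * ϑ ^ m + M * ϑ ^ m
          ≤⟨ +-monoʳ-≤ (X - B * ϑ ^ m) (*-monoʳ-≤-nonNeg (ϑ ^ m) {{nonNegative (0≤^ m 0≤ϑ)}} M≤) ⟩
        X - B * ϑ ^ m + B * (1ℚ - ϑ) * ϑ ^ m
          ≡⟨ solve 4 (λ X B t y → X :- B :* y :+ B :* (con 1ℚ :- t) :* y
               := X :- B :* (t :* y)) refl X B ϑ (ϑ ^ m) ⟩
        X - B * ϑ ^ suc m                          ∎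

    bounded-tail′ : ∀ {z} → Bounded z ρ₀ → ∀ {n k} → n ℕ.≤ k → Bounded (P z k ⊖ P z n) (B * ϑ ^ n)
    bounded-tail′ {z} bz {n} {k} n≤k = bounded-weaken bound
      (subst (λ j → Bounded (P z j ⊖ P z n) (B * ϑ ^ n - B * ϑ ^ j)) (ℕ.m∸n+n≡m n≤k) (bounded-tail bz n (k ℕ.∸ n)))
      where
      bound : B * ϑ ^ n - B * ϑ ^ k ≤ B * ϑ ^ n
      bound = subst (B * ϑ ^ n - B * ϑ ^ k ≤_) (+-identityʳ _)
        (+-monoʳ-≤ (B * ϑ ^ n) (neg-antimono-≤ (0≤* 0≤B (0≤^ k 0≤ϑ))))

    -- The limit is taken along the diagonal, the k-th partial sum at the k-th approximation. Tails
    -- are bounded uniformly in the approximation. Two diagonal entries are compared via the n-th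
    -- partial sums at both approximations, for one fixed n: two tails and one Lipschitz estimate,
    -- ε/3 each.
    converges : ∀ z → ∣ z ∣< fromℚ ρ₀ → SeriesConvergesAt c z
    converges z (ρ , 0≤ρ , ρ<ρ₀ , K₀ , ∣z∣≤ρ) = record { approx = diagonal ; cauchy = cauchy } , limit
      where
      ζ : ℕ → ℚ[i]
      ζ = approx z

      bζ : ∀ {k} → K₀ ℕ.≤ k → Bounded (ζ k) ρ₀
      bζ {k} K₀≤k = bounded-weaken (<⇒≤ ρ<ρ₀) (bounded 0≤ρ (∣z∣≤ρ k K₀≤k))

      bζ₁ : ∀ {k} → K₀ ℕ.≤ k → Bounded (ζ k) 1ℚ
      bζ₁ {k} K₀≤k = bounded-weaken ρ₀≤1 (bζ K₀≤k)

      diagonal : ℕ → ℚ[i]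
      diagonal k = P (ζ k) k

      limit : ∀ ε → 0ℚ < ε → Eventually λ n → Eventually λ k → normSq (P (ζ k) n ⊖ diagonal k) ≤ ε * ε
      limit ε 0<ε = proj₁ (small ε 0<ε) , λ n N≤n → n ℕ.⊔ K₀ , λ k le →
        normSq≤ (bounded-⊖-sym (diagonal k) (P (ζ k) n) (bounded-weaken (proj₂ (small ε 0<ε) n N≤n)
          (bounded-tail′ (bζ (ℕ.≤-trans (ℕ.m≤n⊔m n K₀) le)) (ℕ.≤-trans (ℕ.m≤m⊔n n K₀) le))))

      cauchy : ∀ ε → 0ℚ < ε → ∃[ K ] ∀ j k → K ℕ.≤ j → K ℕ.≤ k → normSq (diagonal j ⊖ diagonal k) ≤ ε * ε
      cauchy ε 0<ε = K , λ j k K≤j K≤k →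
        let n≤ = λ {i} (K≤i : K ℕ.≤ i) → ℕ.≤-trans (ℕ.≤-trans (ℕ.m≤m⊔n n K₀) (ℕ.m≤m⊔n (n ℕ.⊔ K₀) K₁)) K≤i
            K₀≤ = λ {i} (K≤i : K ℕ.≤ i) → ℕ.≤-trans (ℕ.≤-trans (ℕ.m≤n⊔m n K₀) (ℕ.m≤m⊔n (n ℕ.⊔ K₀) K₁)) K≤i
            K₁≤ = λ {i} (K≤i : K ℕ.≤ i) → ℕ.≤-trans (ℕ.m≤n⊔m (n ℕ.⊔ K₀) K₁) K≤i
            tail = λ {i} (K≤i : K ℕ.≤ i) → bounded-weaken (proj₂ (small ε₃ 0<ε₃) n ℕ.≤-refl)
                     (bounded-tail′ (bζ (K₀≤ K≤i)) (n≤ K≤i))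
            middle = bounded-weaken Cδ≤ε₃
                       (lip (bζ₁ (K₀≤ K≤j)) (bζ₁ (K₀≤ K≤k)) (bounded (<⇒≤ 0<δ) (proj₂ close j k (K₁≤ K≤j) (K₁≤ K≤k))))
        in normSq≤ (subst₂ Bounded
             (trans (cong (_⊕ (P (ζ k) n ⊖ diagonal k)) (⊖-telescope (diagonal j) (P (ζ j) n) (P (ζ k) n)))
                    (⊖-telescope (diagonal j) (P (ζ k) n) (diagonal k)))
             (solve 1 (λ ε → ε :* con (ℤ.+ 1 / 3) :+ ε :* con (ℤ.+ 1 / 3) :+ ε :* con (ℤ.+ 1 / 3) := ε) refl ε)
             (bounded-⊕
               (bounded-⊕ (tail K≤j) middle)
               (bounded-⊖-sym (diagonal k) (P (ζ k) n) (tail K≤k))))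
        where
        open +-*-Solver
        ε₃ = ε * (ℤ.+ 1 / 3)
        0<ε₃ : 0ℚ < ε₃
        0<ε₃ = subst (_< ε₃) (*-zeroˡ (ℤ.+ 1 / 3)) (*-monoˡ-<-pos (ℤ.+ 1 / 3) 0<ε)
        n = proj₁ (small ε₃ 0<ε₃)
        C = proj₁ (partialSum-lipschitz c n)
        0≤C = proj₁ (proj₂ (partialSum-lipschitz c n))
        lip = proj₂ (proj₂ (partialSum-lipschitz c n))
        -- The divisor 1 + C stays positive even if C = 0.
        inverse = reciprocal {1ℚ + C} (<-≤-trans (positive⁻¹ 1ℚ) (subst (_≤ 1ℚ + C) (+-identityʳ 1ℚ) (+-monoʳ-≤ 1ℚ 0≤C)))
        r = proj₁ inverse
        δ = r * ε₃
        0<δ : 0ℚ < δ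
        0<δ = subst (_< δ) (*-zeroʳ r) (*-monoʳ-<-pos r {{positive (proj₁ (proj₂ inverse))}} 0<ε₃)
        Cδ≤ε₃ : C * δ ≤ ε₃
        Cδ≤ε₃ = ≤-trans (p≤q+p (<⇒≤ 0<δ)) (≤-reflexive (trans
          (solve 3 (λ C r e → r :* e :+ C :* (r :* e) := r :* (con 1ℚ :+ C) :* e) refl C r ε₃)
          (trans (cong (_* ε₃) (proj₂ (proj₂ inverse))) (*-identityˡ ε₃))))
        close = ℂ.cauchy z δ 0<δ
        K₁ = proj₁ close
        K = (n ℕ.⊔ K₀) ℕ.⊔ K₁

-- Comparison with 1/ω and conclusion

import Data.Nat.Base as ℕ
import Data.Integer.Base as ℤ
open import Data.Rational.Base
open import Data.Rational.Properties
open import Algebra.Definitions.RawSemiring +-*-rawSemiring using (_^_)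
open import Data.List.Base using (length)
open import Data.Sum.Base using (inj₂)
open import Relation.Binary.PropositionalEquality
open import Function.Construct.Composition using (inverse)
open KunzCoordinates
open Enumeration
open WeightedSums
open Codes
open Growth
open Convergence

ω⁻¹<31/50 : ω⁻¹ <ℝ fromℚ (ℤ.+ 31 / 50)
-- 0.619 · 1.6175 > 1.001, and 1.6175 < ω because 2 · 1.6175 - 1 = 2.235 < 2.236 with 2.236² =
-- 4.999696 ≤ 5.
ω⁻¹<31/50 = ℤ.+ 619 / 1000
  , (ℤ.+ 647 / 400 , (ℤ.+ 559 / 250 , decide-< , inj₂ (≤ᵇ⇒≤ _)) , decide-< , decide-<)
  , decide-<

-- Since β θ < 1, θ^n can spare a factor β^n, which eventually exceeds B / ε.
θ-small : ∀ {B} ε → 0ℚ < ε → Eventually λ n → B * θ ^ n ≤ ε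
θ-small {B} ε 0<ε = proj₁ large , λ n N≤n → begin
    B * θ ^ n               ≤⟨ *-monoʳ-≤-nonNeg (θ ^ n) {{nonNegative (0≤^ n 0≤θ)}} (proj₂ large n N≤n) ⟩
    ε * β ^ n * θ ^ n       ≡⟨ *-assoc ε (β ^ n) (θ ^ n) ⟩
    ε * (β ^ n * θ ^ n)     ≡⟨ cong (ε *_) (^-* β θ n) ⟨
    ε * (β * θ) ^ n
      ≤⟨ *-monoˡ-≤-nonNeg ε {{nonNegative (<⇒≤ 0<ε)}} (^-antimono {β * θ} {0} {n} (≤ᵇ⇒≤ _) (≤ᵇ⇒≤ _) ℕ.z≤n) ⟩
    ε * 1ℚ                  ≡⟨ *-identityʳ ε ⟩
    ε                       ∎
  where
  open ≤-Reasoning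
  large = power-unbounded B {δ₀} {ε} decide-< 0<ε

theorem13p2 : Σ[ c̃ ∈ (ℕ → ℕ) ]
    ( (∀ g → HasCardinality (Semigroups3m-1 g) (c̃ g))
    × (∀ g → HasCardinality (Compositions3 g) (c̃ g))
    × (limsup (λ n → root (suc n) (c̃ (suc n))) <ᵁ ω)
    × (Σ[ R ∈ ℝ ] (ω⁻¹ <ℝ R × (∀ z → ∣ z ∣< R → SeriesConvergesAt c̃ z))) )
theorem13p2 = c̃
  , (λ g → inverse (compositions-cardinality g) (compositions↔semigroups g))
  , compositions-cardinality
  , limsup<ω c̃ c̃≤
  -- The radius 0.62 lies between 1/ω, about 0.6180, and 1/τ, about 0.6225.
  , fromℚ (ℤ.+ 31 / 50) , ω⁻¹<31/50
  -- B = 500 M is large enough because 1 - θ, about 0.004, exceeds 1/500.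
  , PowerSeries.converges c̃ {M} {τ} {ℤ.+ 31 / 50} {fromℕ 500 * M} 0≤M 0≤τ (≤ᵇ⇒≤ _) (≤ᵇ⇒≤ _) (≤ᵇ⇒≤ _) (≤ᵇ⇒≤ _) (≤ᵇ⇒≤ _)
      c̃≤ (θ-small {fromℕ 500 * M})
  where
  c̃ : ℕ → ℕ
  c̃ g = length (validWords g)
  c̃≤ : ∀ g → fromℕ (c̃ g) ≤ M * τ ^ g
  c̃≤ g = absorb-polynomial g (validWords-weighted g)
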